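{- Let $r,c,t$ be positive integers. The homology of the complex $(\mathcal{C}(r,c,t),d)$ is concentrated in even ranks, and the homology classes of the basis elements $T\in SSYT(r,c,t)$ that are unmatched by $M$ form an $\mathbb{F}_2$-basis of $H_*(\mathcal{C}(r,c,t),d)$.
   Context: $SSYT(r,c,t)$ is the set of $r\times c$ arrays $T=(T_{R,j})$ (rows $1,\dots,r$ top to bottom) with entries in $\{0,\dots,r+t-1\}$, weakly increasing along rows and strictly increasing down columns, ranked by $\mathrm{rank}(T)=\|T\|-c\binom{r}{2}$ ($\|T\|$ = sum of entries). $\mathcal{C}(r,c,t)$ is the $\mathbb{F}_2$-space with basis $SSYT(r,c,t)$, graded by rank. An occurrence of a value $v$ in row $R$, column $j$, is free if $R=1$ or $T_{R-1,j}\ne v-1$. The boundary $d(T)$ is the sum, over all pairs $(R,v)$ with $v$ odd occurring in row $R$ with an odd number of free occurrences, of the tableau obtained by replacing the leftmost $v$ in row $R$ by $v-1$; $d^2=0$. The matching $M$: $(R,i)$ satisfies (1) if $i$ is odd, occurs in row $R$, and has an odd number of free occurrences in row $R$; $(R,i)$ satisfies (2) if $i$ is even, $i<r+t-1$, $i$ occurs in row $R$, the rightmost $i$ in row $R$ does not have $i+1$ immediately below (vacuous if $R=r$), and the number of free occurrences of $i+1$ in row $R$ is even (possibly zero). $T$ is unmatched if no $(R,i)$ satisfies (1) or (2); otherwise, with $R$ the smallest such row and $i$ the smallest such value in it, $M(T)$ decrements the leftmost $i$ in row $R$ if $i$ is odd and increments the rightmost $i$ in row $R$ if $i$ is even. 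-}

module Defs where

open import Data.Nat using (ℕ; zero; suc; _+_; _*_; _∸_; _<_; _≤_; _≟_; _%_; _≡ᵇ_; _<ᵇ_)
open import Data.Nat.Combinatorics using (_C_)
open import Data.Bool using (Bool; true; false; _∧_; if_then_else_)
open import Data.Fin using (Fin; zero; suc; toℕ; inject₁)
open import Data.Maybe using (Maybe; nothing; just)
open import Data.Product using (_×_; _,_; Σ)
open import Data.Vec as V using (Vec; lookup; updateAt; zip)
import Data.Vec.Properties as VP
open import Data.List as L using (List; []; _∷_; _++_; concatMap; upTo; length; filter)
open import Data.List.Relation.Unary.All using (All)
open import Relation.Nullary using (¬_; does; ¬?)
open import Relation.Nullary.Decidable using (_×-dec_)
open import Relation.Binary.PropositionalEquality using (_≡_; _≢_)

-- An r × c array of naturals, stored as a vector of rows (row 1 = index zero).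
Tab : ℕ → ℕ → Set
Tab r c = Vec (Vec ℕ c) r

entry : ∀ {r c} → Tab r c → Fin r → Fin c → ℕ
entry T R j = lookup (lookup T R) j

IsSSYT : (r c t : ℕ) → Tab r c → Set
IsSSYT r c t T =
  (∀ (R : Fin r) (j : Fin c) → entry T R j < r + t)
  × (∀ (R : Fin r) (j j' : Fin c) → toℕ j ≤ toℕ j' → entry T R j ≤ entry T R j')
  × (∀ (R R' : Fin r) (j : Fin c) → toℕ R < toℕ R' → entry T R j < entry T R' j)

-- ‖T‖ = sum of entries; rank(T) = ‖T‖ - c·binom(r,2)  (exact on SSYT).
norm : ∀ {r c} → Tab r c → ℕ
norm T = V.sum (V.map V.sum T)

rank : ∀ {r c} → Tab r c → ℕ
rank {r} {c} T = norm T ∸ c * (r C 2)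

above : ∀ {r c} → Tab r c → Fin r → Maybe (Vec ℕ c)
above T zero = nothing
above T (suc R) = just (lookup T (inject₁ R))

-- number of free occurrences of v in row R:
-- an occurrence of v in row R, column j is free iff R is the first row
-- or T_{R-1,j} ≠ v-1 (i.e. T_{R-1,j} + 1 ≠ v).
countFree : ∀ {c} → Maybe (Vec ℕ c) → Vec ℕ c → ℕ → ℕ
countFree nothing row v = V.count (λ x → x ≟ v) row
countFree (just a) row v =
  V.count (λ p → (Data.Product.proj₂ p ≟ v) ×-dec ¬? (suc (Data.Product.proj₁ p) ≟ v)) (zip a row)

freeCount : ∀ {r c} → Tab r c → Fin r → ℕ → ℕ
freeCount T R v = countFree (above T R) (lookup T R) v

occCount : ∀ {r c} → Tab r c → Fin r → ℕ → ℕ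
occCount T R v = V.count (λ x → x ≟ v) (lookup T R)

Odd Even : ℕ → Set
Odd n = n % 2 ≡ 1
Even n = n % 2 ≡ 0

isOddᵇ : ℕ → Bool
isOddᵇ n = n % 2 ≡ᵇ 1

decLeftmost : ∀ {c} → ℕ → Vec ℕ c → Vec ℕ c
decLeftmost v V.[] = V.[]
decLeftmost v (x V.∷ xs) = if x ≡ᵇ v then (v ∸ 1) V.∷ xs else x V.∷ decLeftmost v xs

-- Chains of C(r,c,t) over 𝔽₂: finite formal sums, represented as lists of
-- basis elements; the coefficient of T is the multiplicity of T mod 2.
Chain : ℕ → ℕ → Set
Chain r c = List (Tab r c)

IsChain : (r c t : ℕ) → Chain r c → Set
IsChain r c t z = All (IsSSYT r c t) z

Homogeneous : ∀ {r c} → ℕ → Chain r c → Set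
Homogeneous k z = All (λ T → rank T ≡ k) z

mult : ∀ {r c} → Tab r c → Chain r c → ℕ
mult T z = length (filter (λ S → VP.≡-dec (VP.≡-dec _≟_) T S) z)

_≈_ : ∀ {r c} → Chain r c → Chain r c → Set
x ≈ y = ∀ T → mult T x % 2 ≡ mult T y % 2

zeroC : ∀ {r c} → Chain r c
zeroC = []

dTab : (r c t : ℕ) → Tab r c → Chain r c
dTab r c t T =
  concatMap (λ R → concatMap (λ v →
      if isOddᵇ v ∧ (0 <ᵇ occCount T R v) ∧ isOddᵇ (freeCount T R v)
      then updateAt T R (decLeftmost v) ∷ []
      else [])
    (upTo (r + t)))
  (L.allFin r)

d : (r c t : ℕ) → Chain r c → Chain r c
d r c t z = concatMap (dTab r c t) z

Cond1 : ∀ {r c} → Tab r c → Fin r → ℕ → Set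
Cond1 T R i = Odd i × (0 < occCount T R i) × Odd (freeCount T R i)

Cond2 : (r c t : ℕ) → Tab r c → Fin r → ℕ → Set
Cond2 r c t T R i =
  Even i × (i < r + t ∸ 1) × (0 < occCount T R i)
  × (∀ (j : Fin c) → entry T R j ≡ i
       → (∀ (j' : Fin c) → toℕ j < toℕ j' → entry T R j' ≢ i)
       → ∀ (R' : Fin r) → toℕ R' ≡ suc (toℕ R) → entry T R' j ≢ suc i)
  × Even (freeCount T R (suc i))

Unmatched : (r c t : ℕ) → Tab r c → Set
Unmatched r c t T = ∀ (R : Fin r) (i : ℕ) → ¬ Cond1 T R i × ¬ Cond2 r c t T R i

{-# OPTIONS --safe #-}

-- Encode a tableau by the numbers G(R,w) of entries < w in row R. Being an SSYT means
-- G(R,w) ≤ G(R,w+1) and G(R+1,w+1) ≤ G(R,w), so once the even columns of G are fixed, each entry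
-- x = G(R,v) with v odd ranges over an interval [lo,hi], independently of the others. The number of
-- free occurrences of v in row R is hi - x, and lowering the leftmost v replaces x by x + 1. Hence
-- the complex is a direct sum of tensor products of complexes with basis {lo,…,hi} and boundary
-- x ↦ x + 1 if hi - x is odd, x ↦ 0 otherwise; condition (1) says that hi - x is odd, and
-- condition (2), for i = v - 1, that hi - x is even and x > lo.
--
-- Let h raise the first position where (1) or (2) holds if it is (2), and be 0 otherwise, and let
-- π project onto the unmatched tableaux. Then dh + hd = 1 - π, so a cycle z equals πz + d(hz).
-- No unmatched tableau occurs in a boundary, which gives independence.
--
-- If T is unmatched then x = lo and hi - lo is even at every position. As
-- max(a,b) + min(a,b) = a + b, the number of odd entries in row R + 1 is congruent to the number of
-- even entries in row R; hence row R (counted from 0) has sum ≡ Rc and the rank is even.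

module Submission where

open import Defs
open import Data.Nat using (ℕ; zero; suc; pred; _+_; _*_; _∸_; _≤_; _<_; _⊓_; _⊔_; z≤n; s≤s; _≟_; _<?_; _≡ᵇ_; _<ᵇ_; _%_; >-nonZero)
open import Data.Nat.Properties
open import Data.Nat.Combinatorics using (_C_; nC1≡n; nCk+nC[k+1]≡[n+1]C[k+1])
open import Data.Nat.Tactic.RingSolver using (solve-∀)
open import Data.Bool as Bool using (Bool; true; false; not; _xor_; _∧_; if_then_else_)
open import Data.Bool.Properties using (not-distribˡ-xor; xor-assoc; xor-comm; xor-same; xor-identityʳ)
open import Data.Bool.Solver using (module xor-∧-Solver)
open import Data.Fin as Fin using (Fin; zero; suc; toℕ; fromℕ<; inject₁)
open import Data.Fin.Properties using (toℕ<n; toℕ-fromℕ<; toℕ-injective; toℕ-inject₁)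
open import Data.Maybe using (just; nothing)
open import Data.Product using (_×_; _,_; Σ; proj₁; proj₂)
open import Data.Sum using (inj₁; inj₂)
open import Data.Vec as V using (Vec; lookup; updateAt)
import Data.Vec.Properties as VP
open import Data.List using (List; []; _∷_; _++_; concatMap; length; map; filter; upTo; allFin; cartesianProduct)
open import Data.List.Properties using (length-++; filter-++; filter-none; ++-identityʳ; concatMap-++; concatMap-map; concatMap-cong)
open import Data.List.Membership.Propositional using (find)
open import Data.List.Membership.Propositional.Properties using (∈-upTo⁺; ∈-upTo⁻; ∈-allFin; ∈-cartesianProduct⁺)
open import Data.List.Relation.Unary.All as All using (All; []; _∷_)
import Data.List.Relation.Unary.All.Properties as All
open import Data.List.Relation.Unary.AllPairs using (_∷_)
open import Data.List.Relation.Unary.Unique.Propositional using (Unique)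
import Data.List.Relation.Unary.Unique.Propositional.Properties as Unique
open import Function using (_∘_; id)
open import Relation.Nullary using (Dec; ¬_; ¬?; yes; no; does; contradiction)
open import Relation.Nullary.Decidable using (_×-dec_; decidable-stable)
open import Relation.Binary.PropositionalEquality

-- Parities

isOddᵇ-suc : ∀ n → isOddᵇ (suc n) ≡ not (isOddᵇ n)
isOddᵇ-suc zero = refl
isOddᵇ-suc (suc zero) = refl
isOddᵇ-suc (suc (suc n)) = isOddᵇ-suc n

isOddᵇ-+ : ∀ m n → isOddᵇ (m + n) ≡ isOddᵇ m xor isOddᵇ n
isOddᵇ-+ zero n = refl
isOddᵇ-+ (suc m) n = begin
  isOddᵇ (suc (m + n))               ≡⟨ isOddᵇ-suc (m + n) ⟩
  not (isOddᵇ (m + n))               ≡⟨ cong not (isOddᵇ-+ m n) ⟩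
  not (isOddᵇ m xor isOddᵇ n)        ≡⟨ not-distribˡ-xor (isOddᵇ m) (isOddᵇ n) ⟩
  not (isOddᵇ m) xor isOddᵇ n        ≡⟨ cong (_xor isOddᵇ n) (isOddᵇ-suc m) ⟨
  isOddᵇ (suc m) xor isOddᵇ n        ∎
  where open ≡-Reasoning

bit : Bool → ℕ
bit b = if b then 1 else 0

%2≡bit : ∀ n → n % 2 ≡ bit (isOddᵇ n)
%2≡bit zero = refl
%2≡bit (suc zero) = refl
%2≡bit (suc (suc n)) = %2≡bit n

isOddᵇ⇒%2 : ∀ m n → isOddᵇ m ≡ isOddᵇ n → m % 2 ≡ n % 2
isOddᵇ⇒%2 m n eq = trans (%2≡bit m) (trans (cong bit eq) (sym (%2≡bit n)))

%2⇒isOddᵇ : ∀ m n → m % 2 ≡ n % 2 → isOddᵇ m ≡ isOddᵇ n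
%2⇒isOddᵇ m n = cong (_≡ᵇ 1)

<⇒<ᵇ-true : ∀ {m n} → m < n → (m <ᵇ n) ≡ true
<⇒<ᵇ-true {m} {n} p with m <ᵇ n | <⇒<ᵇ p
... | true | _ = refl

odd-∸⇒< : ∀ {x hi} → isOddᵇ (hi ∸ x) ≡ true → x < hi
odd-∸⇒< {x} {hi} h = ≰⇒> λ p → contradiction (trans (sym h) (cong isOddᵇ (m≤n⇒m∸n≡0 p))) λ ()

odd-suc⇒even : ∀ v → isOddᵇ (suc v) ≡ true → isOddᵇ v ≡ false
odd-suc⇒even v o with isOddᵇ v | trans (sym (isOddᵇ-suc v)) o
... | false | _ = refl

isOddᵇ-∸ : ∀ x hi → x < hi → isOddᵇ (hi ∸ x) ≡ not (isOddᵇ (hi ∸ suc x))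
isOddᵇ-∸ x hi p = trans (cong isOddᵇ (+-∸-assoc 1 p)) (isOddᵇ-suc (hi ∸ suc x))

not-flip : ∀ {a b} → a ≡ not b → b ≡ not a
not-flip {b = true} refl = refl
not-flip {b = false} refl = refl

-- Rows

lt : ℕ → ℕ → ℕ
lt x zero = 0
lt zero (suc w) = 1
lt (suc x) (suc w) = lt x w

lt-yes : ∀ {x w} → x < w → lt x w ≡ 1
lt-yes {zero} (s≤s p) = refl
lt-yes {suc x} (s≤s p) = lt-yes p

lt-no : ∀ {x w} → w ≤ x → lt x w ≡ 0
lt-no {w = zero} p = refl
lt-no {suc x} {suc w} (s≤s p) = lt-no p

cnt : ∀ {c} → ℕ → Vec ℕ c → ℕ
cnt w V.[] = 0
cnt w (x V.∷ xs) = lt x w + cnt w xs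

-- A record rather than a bare function type, so that the row can be inferred from a proof of
-- sortedness.
record Sorted {c} (xs : Vec ℕ c) : Set where
  constructor sorted
  field mono : ∀ (j j' : Fin c) → toℕ j ≤ toℕ j' → lookup xs j ≤ lookup xs j'

Sorted-tail : ∀ {c x} {xs : Vec ℕ c} → Sorted (x V.∷ xs) → Sorted xs
Sorted-tail (sorted s) = sorted λ j j' p → s (suc j) (suc j') (s≤s p)

Sorted-cons : ∀ {c x} {xs : Vec ℕ c} → (∀ j → x ≤ lookup xs j) → Sorted xs → Sorted (x V.∷ xs)
Sorted-cons {x = x} {xs} h (sorted s) = sorted mono
  where
  mono : ∀ j j' → toℕ j ≤ toℕ j' → lookup (x V.∷ xs) j ≤ lookup (x V.∷ xs) j'
  mono zero zero p = ≤-refl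
  mono zero (suc j') p = h j'
  mono (suc j) (suc j') (s≤s p) = s j j' p

Sorted-head : ∀ {c x} {xs : Vec ℕ c} → Sorted (x V.∷ xs) → ∀ j → x ≤ lookup xs j
Sorted-head (sorted s) j = s zero (suc j) z≤n

cnt-none : ∀ {c} w (xs : Vec ℕ c) → (∀ j → w ≤ lookup xs j) → cnt w xs ≡ 0
cnt-none w V.[] h = refl
cnt-none w (x V.∷ xs) h = cong₂ _+_ (lt-no (h zero)) (cnt-none w xs (h ∘ suc))

cnt-all : ∀ {c} w (xs : Vec ℕ c) → (∀ j → lookup xs j < w) → cnt w xs ≡ c
cnt-all w V.[] h = refl
cnt-all w (x V.∷ xs) h = cong₂ _+_ (lt-yes (h zero)) (cnt-all w xs (h ∘ suc))

lt-⇒ : ∀ {x y v w} → (x < v → y < w) → lt x v ≤ lt y w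
lt-⇒ {x} {y} {v} {w} h with x <? v
... | yes p rewrite lt-yes p | lt-yes (h p) = ≤-refl
... | no p rewrite lt-no (≮⇒≥ p) = z≤n

cnt-⇒ : ∀ {c} v w (xs ys : Vec ℕ c) →
        (∀ j → lookup xs j < v → lookup ys j < w) → cnt v xs ≤ cnt w ys
cnt-⇒ v w V.[] V.[] h = z≤n
cnt-⇒ v w (x V.∷ xs) (y V.∷ ys) h = +-mono-≤ (lt-⇒ (h zero)) (cnt-⇒ v w xs ys (h ∘ suc))

cnt-mono : ∀ {c} {v w} (xs : Vec ℕ c) → v ≤ w → cnt v xs ≤ cnt w xs
cnt-mono xs p = cnt-⇒ _ _ xs xs (λ j q → <-≤-trans q p)

cnt≤c : ∀ {c} w (xs : Vec ℕ c) → cnt w xs ≤ c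
cnt≤c w V.[] = z≤n
cnt≤c w (x V.∷ xs) with x <? w
... | yes p rewrite lt-yes p = s≤s (cnt≤c w xs)
... | no p rewrite lt-no (≮⇒≥ p) = m≤n⇒m≤1+n (cnt≤c w xs)

-- In a sorted row the entries below `w` fill an initial segment of length `cnt w xs`. This and
-- `index<cnt⇒<` are the two directions of the dictionary between entries and counts.
<⇒index<cnt : ∀ {c w} {xs : Vec ℕ c} → Sorted xs → ∀ j → lookup xs j < w → toℕ j < cnt w xs
<⇒index<cnt {xs = x V.∷ xs} s zero p rewrite lt-yes p = s≤s z≤n
<⇒index<cnt {xs = x V.∷ xs} s (suc j) p
  rewrite lt-yes (≤-<-trans (Sorted-head s j) p) = s≤s (<⇒index<cnt (Sorted-tail s) j p)

index<cnt⇒< : ∀ {c w} {xs : Vec ℕ c} → Sorted xs → ∀ j → toℕ j < cnt w xs → lookup xs j < w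
index<cnt⇒< {w = w} {x V.∷ xs} s j p with x <? w
index<cnt⇒< {w = w} {x V.∷ xs} s zero p | yes q = q
index<cnt⇒< {w = w} {x V.∷ xs} s (suc j) p | yes q rewrite lt-yes q =
  index<cnt⇒< (Sorted-tail s) j (≤-pred p)
... | no q rewrite lt-no (≮⇒≥ q)
                 | cnt-none w xs (λ i → ≤-trans (≮⇒≥ q) (Sorted-head s i)) = contradiction p λ ()

lookup-ext : ∀ {A : Set} {n} {xs ys : Vec A n} → (∀ j → lookup xs j ≡ lookup ys j) → xs ≡ ys
lookup-ext {xs = xs} {ys} h =
  trans (sym (VP.tabulate∘lookup xs)) (trans (VP.tabulate-cong h) (VP.tabulate∘lookup ys))

-- Take `w` one above the entry of one row in column `j`: the column is then counted in both rows,
-- so the other entry is no larger. By symmetry the entries agree.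
cnt-injective : ∀ {c} {xs ys : Vec ℕ c} → Sorted xs → Sorted ys →
                (∀ w → cnt w xs ≡ cnt w ys) → xs ≡ ys
cnt-injective sx sy h = lookup-ext λ j → ≤-antisym
  (≤-pred (index<cnt⇒< sx j (subst (toℕ j <_) (sym (h _)) (<⇒index<cnt sy j ≤-refl))))
  (≤-pred (index<cnt⇒< sy j (subst (toℕ j <_) (h _) (<⇒index<cnt sx j ≤-refl))))

≡ᵇ-refl : ∀ x → (x ≡ᵇ x) ≡ true
≡ᵇ-refl zero = refl
≡ᵇ-refl (suc x) = ≡ᵇ-refl x

≢⇒≡ᵇ-false : ∀ {x y} → x ≢ y → (x ≡ᵇ y) ≡ false
≢⇒≡ᵇ-false {zero} {zero} h = contradiction refl h
≢⇒≡ᵇ-false {zero} {suc y} h = refl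
≢⇒≡ᵇ-false {suc x} {zero} h = refl
≢⇒≡ᵇ-false {suc x} {suc y} h = ≢⇒≡ᵇ-false (h ∘ cong suc)

-- With nothing above, every occurrence is free, and an entry below `suc v` is either below `v` or
-- equal to it. The additive form avoids truncated subtraction.
countFree-nothing : ∀ {c} v (xs : Vec ℕ c) →
  countFree nothing xs v + cnt v xs ≡ cnt (suc v) xs
countFree-nothing v V.[] = refl
countFree-nothing v (x V.∷ xs) with x ≟ v
... | yes refl rewrite ≡ᵇ-refl x | lt-no (≤-refl {x}) | lt-yes (≤-refl {suc x}) =
      cong suc (countFree-nothing v xs)
... | no x≢v rewrite ≢⇒≡ᵇ-false x≢v with x <? v
...   | yes p rewrite lt-yes p | lt-yes (m≤n⇒m≤1+n p) =
        trans (+-suc _ _) (cong suc (countFree-nothing v xs))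
...   | no p rewrite lt-no (≮⇒≥ p) | lt-no (≤∧≢⇒< (≮⇒≥ p) (x≢v ∘ sym)) = countFree-nothing v xs

-- A column with entry at most `v` has an entry below `v` above it, and an occurrence of `suc v` is
-- free exactly when the entry above is below `v`. So the left side counts the columns with lower
-- entry below `suc (suc v)` and upper entry below `v`; both sets are initial segments, and their
-- intersection is the shorter one.
countFree-just : ∀ {c} v (as xs : Vec ℕ c) → Sorted as → Sorted xs →
  (∀ j → lookup as j < lookup xs j) →
  countFree (just as) xs (suc v) + cnt (suc v) xs ≡ cnt (suc (suc v)) xs ⊓ cnt v as
countFree-just v V.[] V.[] sa sx h = refl
countFree-just v (a V.∷ as) (x V.∷ xs) sa sx h
  with x ≟ suc v | a ≟ v | countFree-just v as xs (Sorted-tail sa) (Sorted-tail sx) (h ∘ suc)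
-- An occurrence that is not free: no entry of `as` is below `v`, so the minimum vanishes both here
-- and in `ih`.
... | yes refl | yes refl | ih
  rewrite ≡ᵇ-refl v | lt-no (≤-refl {v}) | cnt-none v as (Sorted-head sa)
        | ⊓-zeroʳ (cnt (suc (suc v)) xs) | ⊓-zeroʳ (lt v (suc v) + cnt (suc (suc v)) xs) = ih
... | yes refl | no a≢v | ih
  rewrite ≡ᵇ-refl v | ≢⇒≡ᵇ-false a≢v | lt-no (≤-refl {v}) | lt-yes (≤-refl {suc v})
        | lt-yes (≤∧≢⇒< (≤-pred (h zero)) a≢v) = cong suc ih
... | no x≢ | _ | ih rewrite ≢⇒≡ᵇ-false x≢ with x <? suc v
...   | yes p rewrite lt-yes p | lt-yes (m≤n⇒m≤1+n p) | lt-yes (<-≤-trans (h zero) (≤-pred p)) =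
        trans (+-suc _ _) (cong suc ih)
-- The head exceeds `suc v`, so no entry of `xs` is below `suc (suc v)` and the minimum vanishes
-- through its first argument.
...   | no p rewrite lt-no (≮⇒≥ p) | lt-no (≤∧≢⇒< (≮⇒≥ p) (x≢ ∘ sym))
                   | cnt-none (suc (suc v)) xs
                       (λ j → ≤-trans (≤∧≢⇒< (≮⇒≥ p) (x≢ ∘ sym)) (Sorted-head sx j)) = ih

-- Supplies the occurrence test of `dTab` once the free count is known to be odd, hence positive.
0<countFree⇒0<count : ∀ {c} m (xs : Vec ℕ c) v → 0 < countFree m xs v → 0 < V.count (_≟ v) xs
0<countFree⇒0<count nothing xs v p = p
0<countFree⇒0<count (just V.[]) V.[] v p = p
0<countFree⇒0<count (just (a V.∷ as)) (x V.∷ xs) v p with x ≡ᵇ v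
... | true = s≤s z≤n
... | false = 0<countFree⇒0<count (just as) xs v p

-- Exchanging an entry `v` with `suc v` is visible only at the threshold `suc v`; this is why a move
-- changes a single count.
lt-suc-≢ : ∀ v w → w ≢ suc v → lt v w ≡ lt (suc v) w
lt-suc-≢ zero zero h = refl
lt-suc-≢ zero (suc zero) h = contradiction refl h
lt-suc-≢ zero (suc (suc w)) h = refl
lt-suc-≢ (suc v) zero h = refl
lt-suc-≢ (suc v) (suc w) h = lt-suc-≢ v w (h ∘ cong suc)

cnt-decLeftmost-≢ : ∀ {c} v w (xs : Vec ℕ c) → w ≢ suc v → cnt w (decLeftmost (suc v) xs) ≡ cnt w xs
cnt-decLeftmost-≢ v w V.[] h = refl
cnt-decLeftmost-≢ v w (x V.∷ xs) h with x ≟ suc v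
... | yes refl rewrite ≡ᵇ-refl v = cong (_+ cnt w xs) (lt-suc-≢ v w h)
... | no p rewrite ≢⇒≡ᵇ-false p = cong (lt x w +_) (cnt-decLeftmost-≢ v w xs h)

-- The inequality `cnt v xs < cnt (suc v) xs` is the encoding of "`v` occurs in `xs`". A head
-- different from `v` contributes equally to both sides.
occurs-tail : ∀ {c} v {x} (xs : Vec ℕ c) → x ≢ v → cnt v (x V.∷ xs) < cnt (suc v) (x V.∷ xs) →
              cnt v xs < cnt (suc v) xs
occurs-tail v {x} xs x≢v h with x <? v
... | yes p rewrite lt-yes p | lt-yes (m≤n⇒m≤1+n p) = ≤-pred h
... | no p rewrite lt-no (≮⇒≥ p) | lt-no (≤∧≢⇒< (≮⇒≥ p) (x≢v ∘ sym)) = h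

cnt-decLeftmost : ∀ {c} v (xs : Vec ℕ c) → cnt (suc v) xs < cnt (suc (suc v)) xs →
                  cnt (suc v) (decLeftmost (suc v) xs) ≡ suc (cnt (suc v) xs)
cnt-decLeftmost v (x V.∷ xs) h with x ≟ suc v
... | yes refl rewrite ≡ᵇ-refl v | lt-no (≤-refl {v}) | lt-yes (≤-refl {suc v}) = refl
... | no p rewrite ≢⇒≡ᵇ-false p =
  trans (cong (lt x (suc v) +_) (cnt-decLeftmost v xs (occurs-tail (suc v) xs p h))) (+-suc _ _)

-- Here it matters that the leftmost occurrence is lowered: an entry in front of it is smaller than
-- `suc v`, hence at most `v`.
decLeftmost-≥ : ∀ {c} v {x} (xs : Vec ℕ c) → x ≢ suc v → (∀ j → x ≤ lookup xs j) →
                ∀ j → x ≤ lookup (decLeftmost (suc v) xs) j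
decLeftmost-≥ v (y V.∷ ys) x≢ h j with y ≟ suc v
decLeftmost-≥ v (y V.∷ ys) x≢ h zero | yes refl rewrite ≡ᵇ-refl v = ≤-pred (≤∧≢⇒< (h zero) x≢)
decLeftmost-≥ v (y V.∷ ys) x≢ h (suc j) | yes refl rewrite ≡ᵇ-refl v = h (suc j)
decLeftmost-≥ v (y V.∷ ys) x≢ h zero | no p rewrite ≢⇒≡ᵇ-false p = h zero
decLeftmost-≥ v (y V.∷ ys) x≢ h (suc j) | no p rewrite ≢⇒≡ᵇ-false p = decLeftmost-≥ v ys x≢ (h ∘ suc) j

decLeftmost-sorted : ∀ {c} v (xs : Vec ℕ c) → Sorted xs → Sorted (decLeftmost (suc v) xs)
decLeftmost-sorted v V.[] s = s
decLeftmost-sorted v (x V.∷ xs) s with x ≟ suc v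
... | yes refl rewrite ≡ᵇ-refl v =
      Sorted-cons (λ j → ≤-trans (n≤1+n v) (Sorted-head s j)) (Sorted-tail s)
... | no p rewrite ≢⇒≡ᵇ-false p =
      Sorted-cons (decLeftmost-≥ v xs p (Sorted-head s)) (decLeftmost-sorted v xs (Sorted-tail s))

-- The first test asks whether `v` occurs further right; only if it does not may the head be raised.
incRightmost : ∀ {c} → ℕ → Vec ℕ c → Vec ℕ c
incRightmost v V.[] = V.[]
incRightmost v (x V.∷ xs) with cnt v xs <? cnt (suc v) xs | x ≟ v
... | yes _ | _     = x V.∷ incRightmost v xs
... | no _  | yes _ = suc v V.∷ xs
... | no _  | no _  = x V.∷ xs

cnt-incRightmost-≢ : ∀ {c} v w (xs : Vec ℕ c) → w ≢ suc v → cnt w (incRightmost v xs) ≡ cnt w xs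
cnt-incRightmost-≢ v w V.[] h = refl
cnt-incRightmost-≢ v w (x V.∷ xs) h with cnt v xs <? cnt (suc v) xs | x ≟ v
... | yes _ | _        = cong (lt x w +_) (cnt-incRightmost-≢ v w xs h)
... | no _  | yes refl = cong (_+ cnt w xs) (sym (lt-suc-≢ v w h))
... | no _  | no _     = refl

cnt-incRightmost : ∀ {c} v (xs : Vec ℕ c) → cnt v xs < cnt (suc v) xs →
                   suc (cnt (suc v) (incRightmost v xs)) ≡ cnt (suc v) xs
cnt-incRightmost v (x V.∷ xs) h with cnt v xs <? cnt (suc v) xs | x ≟ v
... | yes p | _ = trans (sym (+-suc _ _)) (cong (lt x (suc v) +_) (cnt-incRightmost v xs p))
... | no p  | yes refl rewrite lt-no (≤-refl {v}) | lt-yes (≤-refl {suc v}) = refl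
... | no p  | no x≢v = contradiction (occurs-tail v xs x≢v h) p

incRightmost-≥ : ∀ {c} v (xs : Vec ℕ c) j → lookup xs j ≤ lookup (incRightmost v xs) j
incRightmost-≥ v (x V.∷ xs) j with cnt v xs <? cnt (suc v) xs | x ≟ v
incRightmost-≥ v (x V.∷ xs) zero    | yes _ | _ = ≤-refl
incRightmost-≥ v (x V.∷ xs) (suc j) | yes _ | _ = incRightmost-≥ v xs j
incRightmost-≥ v (x V.∷ xs) zero    | no _ | yes refl = n≤1+n v
incRightmost-≥ v (x V.∷ xs) (suc j) | no _ | yes refl = ≤-refl
incRightmost-≥ v (x V.∷ xs) j       | no _ | no _ = ≤-refl

incRightmost-sorted : ∀ {c} v (xs : Vec ℕ c) → Sorted xs → Sorted (incRightmost v xs)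
incRightmost-sorted v V.[] s = s
incRightmost-sorted v (x V.∷ xs) s with cnt v xs <? cnt (suc v) xs | x ≟ v
... | yes _ | _ = Sorted-cons (λ j → ≤-trans (Sorted-head s j) (incRightmost-≥ v xs j))
                              (incRightmost-sorted v xs (Sorted-tail s))
-- A later entry at most `v` would equal `v` by sortedness, against the failed test for an
-- occurrence further right.
... | no p | yes refl = Sorted-cons (λ j → ≰⇒> λ q → p (v-occurs j q)) (Sorted-tail s)
  where
  v-occurs : ∀ j → lookup xs j ≤ v → cnt v xs < cnt (suc v) xs
  v-occurs j q = ≤-<-trans
    (≮⇒≥ λ l → <⇒≱ (index<cnt⇒< (Sorted-tail s) j l) (Sorted-head s j))
    (<⇒index<cnt (Sorted-tail s) j (s≤s q))
... | no p | no _ = s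

sum-incRightmost : ∀ {c} v (xs : Vec ℕ c) → cnt v xs < cnt (suc v) xs →
                   V.sum (incRightmost v xs) ≡ suc (V.sum xs)
sum-incRightmost v (x V.∷ xs) h with cnt v xs <? cnt (suc v) xs | x ≟ v
... | yes p | _ = trans (cong (x +_) (sum-incRightmost v xs p)) (+-suc _ _)
... | no p | yes refl = refl
... | no p | no x≢v = contradiction (occurs-tail v xs x≢v h) p

occurs⇒lookup : ∀ {c v} {xs : Vec ℕ c} → Sorted xs → ∀ j → toℕ j < cnt (suc v) xs → cnt v xs ≤ toℕ j →
                lookup xs j ≡ v
occurs⇒lookup s j p q =
  ≤-antisym (≤-pred (index<cnt⇒< s j p)) (≮⇒≥ λ l → <⇒≱ (<⇒index<cnt s j l) q)

-- `countFree nothing` is by definition the plain number of occurrences, so the identity for a first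
-- row applies to any row.
0<count⇒occurs : ∀ {c} v (xs : Vec ℕ c) → 0 < V.count (_≟ v) xs → cnt v xs < cnt (suc v) xs
0<count⇒occurs v xs p =
  subst (cnt v xs <_) (countFree-nothing v xs) (+-monoˡ-≤ (cnt v xs) p)

occurs⇒0<count : ∀ {c} v (xs : Vec ℕ c) → cnt v xs < cnt (suc v) xs → 0 < V.count (_≟ v) xs
occurs⇒0<count v xs p =
  +-cancelʳ-< (cnt v xs) 0 _ (subst (cnt v xs <_) (sym (countFree-nothing v xs)) p)

-- Chains over 𝔽₂

module _ {r c : ℕ} where

  _≟ᵀ_ : (S T : Tab r c) → Dec (S ≡ T)
  _≟ᵀ_ = VP.≡-dec (VP.≡-dec _≟_)

  coeff : Tab r c → Chain r c → Bool
  coeff U x = isOddᵇ (mult U x)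

  coeff-++ : ∀ U x y → coeff U (x ++ y) ≡ coeff U x xor coeff U y
  coeff-++ U x y = begin
    isOddᵇ (mult U (x ++ y))
      ≡⟨ cong (isOddᵇ ∘ length) (filter-++ (U ≟ᵀ_) x y) ⟩
    isOddᵇ (length (filter (U ≟ᵀ_) x ++ filter (U ≟ᵀ_) y))
      ≡⟨ cong isOddᵇ (length-++ (filter (U ≟ᵀ_) x)) ⟩
    isOddᵇ (mult U x + mult U y)
      ≡⟨ isOddᵇ-+ (mult U x) (mult U y) ⟩
    coeff U x xor coeff U y ∎
    where open ≡-Reasoning

  coeff-∷ : ∀ U T x → coeff U (T ∷ x) ≡ does (U ≟ᵀ T) xor coeff U x
  coeff-∷ U T x with U ≟ᵀ T
  ... | yes _ = isOddᵇ-suc (mult U x)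
  ... | no _ = refl

  infix 4 _∼_
  -- The relation `_≈_` with Boolean coefficients, so that chains can be computed with by `xor` and
  -- its ring solver.
  _∼_ : Chain r c → Chain r c → Set
  x ∼ y = ∀ U → coeff U x ≡ coeff U y

  ∼⇒≈ : ∀ {x y} → x ∼ y → x ≈ y
  ∼⇒≈ {x} {y} h U = isOddᵇ⇒%2 (mult U x) (mult U y) (h U)

  ≈⇒∼ : ∀ {x y} → x ≈ y → x ∼ y
  ≈⇒∼ {x} {y} h U = %2⇒isOddᵇ (mult U x) (mult U y) (h U)

  linearExt : (Tab r c → Bool) → Chain r c → Bool
  linearExt g [] = false
  linearExt g (T ∷ x) = g T xor linearExt g x

  coeff-concatMap : ∀ U (f : Tab r c → Chain r c) x → coeff U (concatMap f x) ≡ linearExt (coeff U ∘ f) x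
  coeff-concatMap U f [] = refl
  coeff-concatMap U f (T ∷ x) =
    trans (coeff-++ U (f T) (concatMap f x)) (cong (coeff U (f T) xor_) (coeff-concatMap U f x))

  remove : Tab r c → Chain r c → Chain r c
  remove T [] = []
  remove T (S ∷ x) with T ≟ᵀ S
  ... | yes _ = remove T x
  ... | no _ = S ∷ remove T x

  length-remove : ∀ T x → length (remove T x) ≤ length x
  length-remove T [] = z≤n
  length-remove T (S ∷ x) with T ≟ᵀ S
  ... | yes _ = m≤n⇒m≤1+n (length-remove T x)
  ... | no _ = s≤s (length-remove T x)

  -- All copies of `T` are split off at once; each contributes `g T`, so only the parity of their
  -- number survives.
  linearExt-remove : ∀ g T x → linearExt g x ≡ (coeff T x ∧ g T) xor linearExt g (remove T x)
  linearExt-remove g T [] = refl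
  linearExt-remove g T (S ∷ x) with ih ← linearExt-remove g T x | T ≟ᵀ S
  ... | yes refl rewrite isOddᵇ-suc (mult T x) | ih =
    solve 3 (λ a b e → a :+ ((b :* a) :+ e) := ((con true :+ b) :* a) :+ e) refl
      (g T) (coeff T x) (linearExt g (remove T x))
    where open xor-∧-Solver
  ... | no _ rewrite ih =
    solve 3 (λ a b e → a :+ (b :+ e) := b :+ (a :+ e)) refl
      (g S) (coeff T x ∧ g T) (linearExt g (remove T x))
    where open xor-∧-Solver

  coeff-remove : ∀ U T x → coeff U (remove T x) ≡ not (does (U ≟ᵀ T)) ∧ coeff U x
  coeff-remove U T [] with U ≟ᵀ T
  ... | yes _ = refl
  ... | no _ = refl
  coeff-remove U T (S ∷ x) with ih ← coeff-remove U T x | T ≟ᵀ S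
  coeff-remove U T (S ∷ x) | yes refl with U ≟ᵀ S
  ... | yes _ = ih
  ... | no _ = ih
  coeff-remove U T (S ∷ x) | no T≢S rewrite coeff-∷ U S (remove T x) | ih with U ≟ᵀ S | U ≟ᵀ T
  ... | yes refl | yes refl = contradiction refl T≢S
  ... | yes refl | no _ = sym (isOddᵇ-suc (mult U x))
  ... | no _ | yes _ = refl
  ... | no _ | no _ = refl

  -- A chain that is zero mod 2 need not be the empty list. Its head occurs an even number of times,
  -- so removing all copies keeps the value and the vanishing of coefficients. The recursion runs on
  -- a bound for the length, since the shortened list is not a structural part of `x`.
  linearExt-zero : ∀ g x → x ∼ [] → linearExt g x ≡ false
  linearExt-zero g x = go (length x) x ≤-refl
    where
    go : ∀ n x → length x ≤ n → x ∼ [] → linearExt g x ≡ false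
    go n [] p h = refl
    go (suc n) (T ∷ x) (s≤s p) h = begin
      linearExt g (T ∷ x)
        ≡⟨ linearExt-remove g T (T ∷ x) ⟩
      (coeff T (T ∷ x) ∧ g T) xor linearExt g (remove T (T ∷ x))
        ≡⟨ cong (λ b → (b ∧ g T) xor linearExt g (remove T (T ∷ x))) (h T) ⟩
      linearExt g (remove T (T ∷ x))
        ≡⟨ go n (remove T (T ∷ x)) (≤-trans shorter p) vanishes ⟩
      false ∎
      where
      open ≡-Reasoning
      shorter : length (remove T (T ∷ x)) ≤ length x
      shorter with T ≟ᵀ T
      ... | yes _ = length-remove T x
      ... | no q = contradiction refl q
      vanishes : remove T (T ∷ x) ∼ []
      vanishes U rewrite coeff-remove U T (T ∷ x) | h U with U ≟ᵀ T
      ... | yes _ = refl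
      ... | no _ = refl

  -- Needed for the term h(dz) of a cycle z, where dz vanishes only mod 2.
  concatMap-zero : ∀ f x → x ∼ [] → concatMap f x ∼ []
  concatMap-zero f x h U = trans (coeff-concatMap U f x) (linearExt-zero (coeff U ∘ f) x h)

concatMap-congᴬ : ∀ {A B : Set} {f g : A → List B} {xs} →
                  All (λ x → f x ≡ g x) xs → concatMap f xs ≡ concatMap g xs
concatMap-congᴬ [] = refl
concatMap-congᴬ (p ∷ ps) = cong₂ _++_ p (concatMap-congᴬ ps)

concatMap-nil : ∀ {A B : Set} {f : A → List B} {xs} →
                All (λ x → f x ≡ []) xs → concatMap f xs ≡ []
concatMap-nil [] = refl
concatMap-nil (p ∷ ps) rewrite p = concatMap-nil ps

concatMap-singleton : ∀ {A B : Set} {f : A → List B} {g : A → B} {xs} →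
                      All (λ x → f x ≡ g x ∷ []) xs → concatMap f xs ≡ map g xs
concatMap-singleton [] = refl
concatMap-singleton (p ∷ ps) rewrite p = cong (_ ∷_) (concatMap-singleton ps)

-- The contracting homotopy

-- At a position `(R , v)` with `v` odd, `lowerable` will be condition (1) for the value `v` and
-- `raisable` condition (2) for the value `v - 1`.
data Status : Set where
  lowerable raisable stuck : Status

opposite : Status → Status
opposite lowerable = raisable
opposite raisable = lowerable
opposite stuck = stuck

opposite≢stuck : ∀ {s s'} → s' ≡ opposite s → s ≢ stuck → s' ≢ stuck
opposite≢stuck {lowerable} refl h ()
opposite≢stuck {raisable} refl h ()
opposite≢stuck {stuck} refl h = h

ifLowerable : ∀ {A : Set} → Status → A → List A
ifLowerable lowerable x = x ∷ []
ifLowerable raisable x = []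
ifLowerable stuck x = []

-- An abstract tensor product with one factor per position: the parameters say that each factor is
-- matched by an involution and that different factors do not interact.
module Homotopy {r c : ℕ} {Pos : Set} (Valid : Tab r c → Set)
  (st : Pos → Tab r c → Status) (flip : Pos → Tab r c → Tab r c)
  (st-flip : ∀ {p T} → Valid T → st p T ≢ stuck → st p (flip p T) ≡ opposite (st p T))
  (flip-flip : ∀ {p T} → Valid T → st p T ≢ stuck → flip p (flip p T) ≡ T)
  (st-flip-≢ : ∀ {p q T} → p ≢ q → Valid T → st q T ≢ stuck → st p (flip q T) ≡ st p T)
  (flip-comm : ∀ {p q T} → p ≢ q → Valid T → st p T ≢ stuck → st q T ≢ stuck →
               flip q (flip p T) ≡ flip p (flip q T))
  where

  ∂ : List Pos → Tab r c → Chain r c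
  ∂ ps T = concatMap (λ p → ifLowerable (st p T) (flip p T)) ps

  -- The map h of the overview. The order of the list decides which position comes first;
  -- `positions` will run through the rows and, within a row, through the values, as the matching
  -- does.
  η : List Pos → Tab r c → Chain r c
  η [] T = []
  η (p ∷ ps) T with st p T
  ... | lowerable = []
  ... | raisable = flip p T ∷ []
  ... | stuck = η ps T

  π : List Pos → Tab r c → Chain r c
  π [] T = T ∷ []
  π (p ∷ ps) T with st p T
  ... | lowerable = []
  ... | raisable = []
  ... | stuck = π ps T

  ≢stuck : ∀ {p T s} → st p T ≡ s → s ≢ stuck → st p T ≢ stuck
  ≢stuck eq h e = h (trans (sym eq) e)

  ∂-all : ∀ {P : Tab r c → Set} ps {T} → All (λ p → st p T ≡ lowerable → P (flip p T)) ps → All P (∂ ps T)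
  ∂-all [] [] = []
  ∂-all (p ∷ ps) {T} (h ∷ hs) with st p T
  ... | lowerable = h refl ∷ ∂-all ps hs
  ... | raisable = ∂-all ps hs
  ... | stuck = ∂-all ps hs

  η-all : ∀ {P : Tab r c → Set} ps {T} → All (λ p → st p T ≡ raisable → P (flip p T)) ps → All P (η ps T)
  η-all [] [] = []
  η-all (p ∷ ps) {T} (h ∷ hs) with st p T
  ... | lowerable = []
  ... | raisable = h refl ∷ []
  ... | stuck = η-all ps hs

  π-all : ∀ ps {T} → All (λ S → S ≡ T × All (λ p → st p T ≡ stuck) ps) (π ps T)
  π-all [] = (refl , []) ∷ []
  π-all (p ∷ ps) {T} with st p T in eq
  ... | lowerable = []
  ... | raisable = []
  ... | stuck = All.map (λ (e , s) → e , eq ∷ s) (π-all ps)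

  η-raisable : ∀ p ps {T} → st p T ≡ raisable → η (p ∷ ps) T ≡ flip p T ∷ []
  η-raisable p ps eq rewrite eq = refl

  η-lowerable : ∀ p ps {T} → st p T ≡ lowerable → η (p ∷ ps) T ≡ []
  η-lowerable p ps eq rewrite eq = refl

  η-stuck : ∀ p ps {T} → st p T ≡ stuck → η (p ∷ ps) T ≡ η ps T
  η-stuck p ps eq rewrite eq = refl

  ∂-lowerable : ∀ p ps {T} → st p T ≡ lowerable → ∂ (p ∷ ps) T ≡ flip p T ∷ ∂ ps T
  ∂-lowerable p ps eq rewrite eq = refl

  ∂-skip : ∀ p ps {T s} → st p T ≡ s → s ≢ lowerable → ∂ (p ∷ ps) T ≡ ∂ ps T
  ∂-skip p ps {s = lowerable} eq h = contradiction refl h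
  ∂-skip p ps {s = raisable} eq h rewrite eq = refl
  ∂-skip p ps {s = stuck} eq h rewrite eq = refl

  st-∂ : ∀ {p T} ps → All (p ≢_) ps → Valid T → All (λ S → st p S ≡ st p T) (∂ ps T)
  st-∂ ps hs v = ∂-all ps (All.map (λ p≢q e → st-flip-≢ p≢q v (≢stuck e λ ())) hs)

  st-η : ∀ {p T} ps → All (p ≢_) ps → Valid T → All (λ S → st p S ≡ st p T) (η ps T)
  st-η ps hs v = η-all ps (All.map (λ p≢q e → st-flip-≢ p≢q v (≢stuck e λ ())) hs)

  ∂-flip : ∀ {p T} ps → All (p ≢_) ps → Valid T → st p T ≢ stuck → ∂ ps (flip p T) ≡ map (flip p) (∂ ps T)
  ∂-flip [] [] v n = refl
  ∂-flip {p} {T} (q ∷ ps) (p≢q ∷ hs) v n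
    rewrite st-flip-≢ (p≢q ∘ sym) v n with st q T in eq
  ... | lowerable = cong₂ _∷_ (flip-comm p≢q v n (≢stuck eq λ ())) (∂-flip ps hs v n)
  ... | raisable = ∂-flip ps hs v n
  ... | stuck = ∂-flip ps hs v n

  -- The relation dh + hd + π = 1 on a basis element. The first position `p` governs the cases,
  -- since flips at the later positions, all distinct from `p`, preserve the status at `p`.
  homotopy : ∀ ps {T} → Unique ps → Valid T →
             (concatMap (∂ ps) (η ps T) ++ concatMap (η ps) (∂ ps T)) ++ π ps T ∼ T ∷ []
  homotopy [] u v U = refl
  homotopy (p ∷ ps) {T} (p∉ps ∷ u) v U with st p T in eq
  -- All tableaux in `∂ ps T` and `η ps T` are stuck at `p` as well, so `p` drops out of every term.
  ... | stuck = trans (cong (coeff U) (cong (_++ π ps T) (cong₂ _++_ ∂η η∂))) (homotopy ps u v U)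
    where
    ∂η : concatMap (∂ (p ∷ ps)) (η ps T) ≡ concatMap (∂ ps) (η ps T)
    ∂η = concatMap-congᴬ (All.map (λ e → ∂-skip p ps (trans e eq) λ ()) (st-η ps p∉ps v))
    η∂ : concatMap (η (p ∷ ps)) (∂ ps T) ≡ concatMap (η ps) (∂ ps T)
    η∂ = concatMap-congᴬ (All.map (λ e → η-stuck p ps (trans e eq)) (st-∂ ps p∉ps v))
  -- Here h T is `flip p T`, with boundary `T` plus `L`; the term hd T is `L` too, and the two
  -- copies cancel.
  ... | raisable = begin
      coeff U (((∂ (p ∷ ps) (flip p T) ++ []) ++ concatMap (η (p ∷ ps)) (∂ ps T)) ++ [])
        ≡⟨ cong (coeff U) terms ⟩
      coeff U ((T ∷ L) ++ L)
        ≡⟨ coeff-++ U (T ∷ L) L ⟩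
      coeff U (T ∷ L) xor coeff U L
        ≡⟨ cong (_xor coeff U L) (coeff-++ U (T ∷ []) L) ⟩
      (coeff U (T ∷ []) xor coeff U L) xor coeff U L
        ≡⟨ xor-assoc (coeff U (T ∷ [])) (coeff U L) (coeff U L) ⟩
      coeff U (T ∷ []) xor (coeff U L xor coeff U L)
        ≡⟨ cong (coeff U (T ∷ []) xor_) (xor-same (coeff U L)) ⟩
      coeff U (T ∷ []) xor false
        ≡⟨ xor-identityʳ _ ⟩
      coeff U (T ∷ []) ∎
    where
    open ≡-Reasoning
    n : st p T ≢ stuck
    n = ≢stuck eq λ ()
    L : Chain r c
    L = map (flip p) (∂ ps T)
    ∂η : ∂ (p ∷ ps) (flip p T) ≡ T ∷ L
    ∂η = trans (∂-lowerable p ps (trans (st-flip v n) (cong opposite eq)))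
               (cong₂ _∷_ (flip-flip v n) (∂-flip ps p∉ps v n))
    η∂ : concatMap (η (p ∷ ps)) (∂ ps T) ≡ L
    η∂ = concatMap-singleton (All.map (λ e → η-raisable p ps (trans e eq)) (st-∂ ps p∉ps v))
    terms : ((∂ (p ∷ ps) (flip p T) ++ []) ++ concatMap (η (p ∷ ps)) (∂ ps T)) ++ [] ≡ (T ∷ L) ++ L
    terms = trans (++-identityʳ _) (cong₂ _++_ (trans (++-identityʳ _) ∂η) η∂)
  -- Here h T is zero. The term `flip p T` of the boundary is raised back to `T`; the other terms
  -- remain lowerable at `p`, and h kills them.
  ... | lowerable = cong (coeff U) terms
    where
    n : st p T ≢ stuck
    n = ≢stuck eq λ ()
    terms : (η (p ∷ ps) (flip p T) ++ concatMap (η (p ∷ ps)) (∂ ps T)) ++ [] ≡ T ∷ []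
    terms = trans (++-identityʳ _) (cong₂ _++_
      (trans (η-raisable p ps (trans (st-flip v n) (cong opposite eq))) (cong (_∷ []) (flip-flip v n)))
      (concatMap-nil (All.map (λ e → η-lowerable p ps (trans e eq)) (st-∂ ps p∉ps v))))

  module _ (ps : List Pos) (unique : Unique ps) where

    homotopyᶜ : ∀ z → All Valid z →
      z ∼ (concatMap (π ps) z ++ concatMap (∂ ps) (concatMap (η ps) z)) ++ concatMap (η ps) (concatMap (∂ ps) z)
    homotopyᶜ [] [] U = refl
    homotopyᶜ (T ∷ z) (v ∷ vs) U = begin
      coeff U (T ∷ z)
        ≡⟨ coeff-++ U (T ∷ []) z ⟩
      coeff U (T ∷ []) xor coeff U z
        ≡⟨ cong₂ _xor_ (sym (homotopy ps unique v U)) (homotopyᶜ z vs U) ⟩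
      coeff U ((∂ηT ++ η∂T) ++ πT) xor coeff U ((πz ++ ∂ηz) ++ η∂z)
        ≡⟨ cong₂ _xor_ (coeff-++₃ ∂ηT η∂T πT) (coeff-++₃ πz ∂ηz η∂z) ⟩
      ((coeff U ∂ηT xor coeff U η∂T) xor coeff U πT) xor ((coeff U πz xor coeff U ∂ηz) xor coeff U η∂z)
        ≡⟨ solve 6 (λ a b e x y w → ((a :+ b) :+ e) :+ ((x :+ y) :+ w) := ((e :+ x) :+ (a :+ y)) :+ (b :+ w)) refl
             (coeff U ∂ηT) (coeff U η∂T) (coeff U πT) (coeff U πz) (coeff U ∂ηz) (coeff U η∂z) ⟩
      ((coeff U πT xor coeff U πz) xor (coeff U ∂ηT xor coeff U ∂ηz)) xor (coeff U η∂T xor coeff U η∂z)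
        ≡⟨ cong₂ _xor_ (cong₂ _xor_ (coeff-++ U πT πz) (coeff-++ U ∂ηT ∂ηz)) (coeff-++ U η∂T η∂z) ⟨
      (coeff U (πT ++ πz) xor coeff U (∂ηT ++ ∂ηz)) xor coeff U (η∂T ++ η∂z)
        ≡⟨ coeff-++₃ (πT ++ πz) (∂ηT ++ ∂ηz) (η∂T ++ η∂z) ⟨
      coeff U (((πT ++ πz) ++ (∂ηT ++ ∂ηz)) ++ (η∂T ++ η∂z))
        ≡⟨ cong₂ (λ x y → coeff U (((πT ++ πz) ++ x) ++ y))
             (concatMap-++ (∂ ps) (η ps T) (concatMap (η ps) z))
             (concatMap-++ (η ps) (∂ ps T) (concatMap (∂ ps) z)) ⟨
      coeff U ((concatMap (π ps) (T ∷ z) ++ concatMap (∂ ps) (concatMap (η ps) (T ∷ z)))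
               ++ concatMap (η ps) (concatMap (∂ ps) (T ∷ z))) ∎
      where
      open ≡-Reasoning
      open xor-∧-Solver
      ∂ηT = concatMap (∂ ps) (η ps T)
      η∂T = concatMap (η ps) (∂ ps T)
      πT = π ps T
      πz = concatMap (π ps) z
      ∂ηz = concatMap (∂ ps) (concatMap (η ps) z)
      η∂z = concatMap (η ps) (concatMap (∂ ps) z)
      coeff-++₃ : ∀ x y w → coeff U ((x ++ y) ++ w) ≡ (coeff U x xor coeff U y) xor coeff U w
      coeff-++₃ x y w = trans (coeff-++ U (x ++ y) w) (cong (_xor coeff U w) (coeff-++ U x y))

    cycle-decomposition : ∀ z → All Valid z → concatMap (∂ ps) z ∼ [] →
      z ∼ concatMap (π ps) z ++ concatMap (∂ ps) (concatMap (η ps) z)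
    cycle-decomposition z vs ∂z∼0 U = begin
      coeff U z                                    ≡⟨ homotopyᶜ z vs U ⟩
      coeff U (w ++ concatMap (η ps) (concatMap (∂ ps) z))
                                                   ≡⟨ coeff-++ U w _ ⟩
      coeff U w xor coeff U (concatMap (η ps) (concatMap (∂ ps) z))
        ≡⟨ cong (coeff U w xor_) (concatMap-zero (η ps) (concatMap (∂ ps) z) ∂z∼0 U) ⟩
      coeff U w xor false                          ≡⟨ xor-identityʳ _ ⟩
      coeff U w                                    ∎
      where
      open ≡-Reasoning
      w = concatMap (π ps) z ++ concatMap (∂ ps) (concatMap (η ps) z)

-- Counting patterns of tableaux

module _ {c : ℕ} where

  rowCnt : ∀ {r} → Tab r c → ℕ → ℕ → ℕ
  rowCnt V.[] n w = 0
  rowCnt (x V.∷ T) zero w = cnt w x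
  rowCnt (x V.∷ T) (suc n) w = rowCnt T n w

  -- Row 0 is a virtual row of negative entries, row n + 1 is the row of T with index n,
  -- and the rows below T consist of infinite entries.
  G : ∀ {r} → Tab r c → ℕ → ℕ → ℕ
  G T zero w = c
  G T (suc n) w = rowCnt T n w

  rowCnt-lookup : ∀ {r} (T : Tab r c) R w → rowCnt T (toℕ R) w ≡ cnt w (lookup T R)
  rowCnt-lookup (x V.∷ T) zero w = refl
  rowCnt-lookup (x V.∷ T) (suc R) w = rowCnt-lookup T R w

  rowCnt-outside : ∀ {r} (T : Tab r c) {n} w → r ≤ n → rowCnt T n w ≡ 0
  rowCnt-outside V.[] w p = refl
  rowCnt-outside (x V.∷ T) w (s≤s p) = rowCnt-outside T w p

  rowCnt-mono : ∀ {r} (T : Tab r c) n {v w} → v ≤ w → rowCnt T n v ≤ rowCnt T n w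
  rowCnt-mono V.[] n p = z≤n
  rowCnt-mono (x V.∷ T) zero p = cnt-mono x p
  rowCnt-mono (x V.∷ T) (suc n) p = rowCnt-mono T n p

  G-mono : ∀ {r} (T : Tab r c) n {v w} → v ≤ w → G T n v ≤ G T n w
  G-mono T zero p = ≤-refl
  G-mono T (suc n) p = rowCnt-mono T n p

  G≤c : ∀ {r} (T : Tab r c) n w → G T n w ≤ c
  G≤c T zero w = ≤-refl
  G≤c V.[] (suc n) w = z≤n
  G≤c (x V.∷ T) (suc zero) w = cnt≤c w x
  G≤c (x V.∷ T) (suc (suc n)) w = G≤c T (suc n) w

  rowCnt-updateAt : ∀ {r} (T : Tab r c) R f w → rowCnt (updateAt T R f) (toℕ R) w ≡ cnt w (f (lookup T R))
  rowCnt-updateAt (x V.∷ T) zero f w = refl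
  rowCnt-updateAt (x V.∷ T) (suc R) f w = rowCnt-updateAt T R f w

  rowCnt-updateAt-≢ : ∀ {r} (T : Tab r c) R f {n} w → n ≢ toℕ R → rowCnt (updateAt T R f) n w ≡ rowCnt T n w
  rowCnt-updateAt-≢ (x V.∷ T) zero f {zero} w h = contradiction refl h
  rowCnt-updateAt-≢ (x V.∷ T) zero f {suc n} w h = refl
  rowCnt-updateAt-≢ (x V.∷ T) (suc R) f {zero} w h = refl
  rowCnt-updateAt-≢ (x V.∷ T) (suc R) f {suc n} w h = rowCnt-updateAt-≢ T R f w (h ∘ cong suc)

  -- With the even columns of G fixed, an entry G T (suc n) v in an odd column v ranges
  -- over the interval [lower T n v , upper T n v], independently of the other ones.
  lower upper : ∀ {r} → Tab r c → ℕ → ℕ → ℕ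
  lower T n v = G T (suc n) (pred v) ⊔ G T (suc (suc n)) (suc v)
  upper T n v = G T (suc n) (suc v) ⊓ G T n (pred v)

  -- Both moves at `v` affect the same count: the leftmost `v` crosses the threshold `v` downwards,
  -- or the rightmost `v - 1` crosses it upwards.
  move : Status → ℕ → Vec ℕ c → Vec ℕ c
  move lowerable (suc v) = decLeftmost (suc v)
  move raisable (suc v) = incRightmost v
  move _ _ = id

  cnt-move-≢ : ∀ s v {w} xs → w ≢ v → cnt w (move s v xs) ≡ cnt w xs
  cnt-move-≢ lowerable zero xs h = refl
  cnt-move-≢ lowerable (suc v) xs h = cnt-decLeftmost-≢ v _ xs h
  cnt-move-≢ raisable zero xs h = refl
  cnt-move-≢ raisable (suc v) xs h = cnt-incRightmost-≢ v _ xs h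
  cnt-move-≢ stuck v xs h = refl

  move-sorted : ∀ s v {xs} → Sorted xs → Sorted (move s v xs)
  move-sorted lowerable zero h = h
  move-sorted lowerable (suc v) h = decLeftmost-sorted v _ h
  move-sorted raisable zero h = h
  move-sorted raisable (suc v) h = incRightmost-sorted v _ h
  move-sorted stuck v h = h

-- Positions, flips and their independence

status : ℕ → ℕ → ℕ → Status
status lo x hi = if isOddᵇ (hi ∸ x) then lowerable else if lo <ᵇ x then raisable else stuck

-- The direction is reversed: lowering an entry adds one to the number of entries below the
-- threshold.
shift : Status → ℕ → ℕ
shift lowerable = suc
shift raisable = pred
shift stuck = id

module _ {r c : ℕ} (t : ℕ) where

  -- Semistandardness read off from `G`: `interlace` is strictness down the columns and `full` is
  -- the bound on the entries.
  record Valid (T : Tab r c) : Set where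
    constructor valid
    field
      rows-sorted : ∀ R → Sorted (lookup T R)
      interlace   : ∀ n w → G T (suc n) (suc w) ≤ G T n w
      full        : ∀ n → n < r → G T (suc n) (r + t) ≡ c

  IsSSYT⇒Valid : ∀ {T} → IsSSYT r c t T → Valid T
  IsSSYT⇒Valid {T} (bnd , inc , strict) = valid (λ R → sorted (inc R)) inter full
    where
    inter : ∀ n w → G T (suc n) (suc w) ≤ G T n w
    inter zero w = G≤c T 1 (suc w)
    inter (suc n) w with suc n <? r
    ... | no q rewrite rowCnt-outside T (suc w) (≮⇒≥ q) = z≤n
    ... | yes q = subst₂ (λ a b → rowCnt T a (suc w) ≤ rowCnt T b w) eq' eq
      (subst₂ _≤_ (sym (rowCnt-lookup T R' (suc w))) (sym (rowCnt-lookup T R w))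
        (cnt-⇒ (suc w) w (lookup T R') (lookup T R)
          (λ j p → <-≤-trans (strict R R' j (≤-reflexive (trans (cong suc eq) (sym eq')))) (≤-pred p))))
      where
      R = fromℕ< (<-trans (n<1+n n) q)
      R' = fromℕ< q
      eq : toℕ R ≡ n
      eq = toℕ-fromℕ< _
      eq' : toℕ R' ≡ suc n
      eq' = toℕ-fromℕ< _
    full : ∀ n → n < r → rowCnt T n (r + t) ≡ c
    full n p = subst (λ a → rowCnt T a (r + t) ≡ c) (toℕ-fromℕ< p)
      (trans (rowCnt-lookup T (fromℕ< p) (r + t)) (cnt-all (r + t) (lookup T (fromℕ< p)) (bnd (fromℕ< p))))

  Valid⇒IsSSYT : ∀ {T} → Valid T → IsSSYT r c t T
  Valid⇒IsSSYT {T} (valid srt inter full) = bnd , (λ R → Sorted.mono (srt R)) , strict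
    where
    bnd : ∀ R j → entry T R j < r + t
    bnd R j = index<cnt⇒< (srt R) j
      (subst (toℕ j <_) (trans (sym (full (toℕ R) (toℕ<n R))) (rowCnt-lookup T R (r + t))) (toℕ<n j))
    antitone : ∀ m n w → m ≤ n → G T n w ≤ G T m w
    antitone m zero w z≤n = ≤-refl
    antitone m (suc n) w p with m ≟ suc n
    ... | yes refl = ≤-refl
    ... | no q = ≤-trans (G-mono T (suc n) (n≤1+n w))
                   (≤-trans (inter n w) (antitone m n w (≤-pred (≤∧≢⇒< p q))))
    strict : ∀ R R' j → toℕ R < toℕ R' → entry T R j < entry T R' j
    -- With `x` the entry in row `R'`, column `j` is counted there at threshold `suc x`; interlacing
    -- then counts it at threshold `x` in row `R`.
    strict R R' j p = index<cnt⇒< (srt R) j (≤-trans (<⇒index<cnt (srt R') j ≤-refl) (subst₂ _≤_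
      (rowCnt-lookup T R' (suc x)) (rowCnt-lookup T R x)
      (≤-trans (inter (toℕ R') x) (antitone (suc (toℕ R)) (toℕ R') x p))))
      where x = entry T R' j

  G-injective : ∀ {S T} → Valid S → Valid T → (∀ n w → G S n w ≡ G T n w) → S ≡ T
  G-injective {S} {T} vS vT h = lookup-ext λ R →
    cnt-injective (Valid.rows-sorted vS R) (Valid.rows-sorted vT R) λ w →
      trans (sym (rowCnt-lookup S R w)) (trans (h (suc (toℕ R)) w) (rowCnt-lookup T R w))

  st : Fin r × ℕ → Tab r c → Status
  st (R , v) T = if isOddᵇ v ∧ (v <ᵇ (r + t))
    then status (lower T (toℕ R) v) (G T (suc (toℕ R)) v) (upper T (toℕ R) v) else stuck

  flip : Fin r × ℕ → Tab r c → Tab r c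
  flip (R , v) T = updateAt T R (move (st (R , v) T) v)

  lower≤ : ∀ {T} → Valid T → ∀ n v → lower T n v ≤ G T (suc n) v
  lower≤ {T} V n v = ⊔-lub (G-mono T (suc n) pred[n]≤n) (Valid.interlace V (suc n) v)

  ≤upper : ∀ {T} → Valid T → ∀ n v → G T (suc n) (suc v) ≤ upper T n (suc v)
  ≤upper {T} V n v = ⊓-glb (G-mono T (suc n) (n≤1+n _)) (Valid.interlace V n v)

  -- The evidence behind a status other than `stuck`, to be matched on instead of the nested tests
  -- in `st`. As `v` is odd, it is a successor.
  data View (T : Tab r c) (R : Fin r) : ℕ → Status → Set where
    isLowerable : ∀ {v} → isOddᵇ (suc v) ≡ true → suc v < r + t →
      isOddᵇ (upper T (toℕ R) (suc v) ∸ G T (suc (toℕ R)) (suc v)) ≡ true →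
      View T R (suc v) lowerable
    isRaisable : ∀ {v} → isOddᵇ (suc v) ≡ true → suc v < r + t →
      isOddᵇ (upper T (toℕ R) (suc v) ∸ G T (suc (toℕ R)) (suc v)) ≡ false →
      lower T (toℕ R) (suc v) < G T (suc (toℕ R)) (suc v) →
      View T R (suc v) raisable

  view : ∀ T R v → st (R , v) T ≢ stuck → View T R v (st (R , v) T)
  view T R zero h = contradiction refl h
  view T R (suc v) h with isOddᵇ (suc v) in eo | suc v <ᵇ (r + t) in ev
  ... | false | _ = contradiction refl h
  ... | true | false = contradiction refl h
  ... | true | true with isOddᵇ (upper T (toℕ R) (suc v) ∸ G T (suc (toℕ R)) (suc v)) in eu
  ...   | true = isLowerable eo (<ᵇ⇒< _ _ (subst Bool.T (sym ev) _)) eu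
  ...   | false with lower T (toℕ R) (suc v) <ᵇ G T (suc (toℕ R)) (suc v) in el
  ...     | true = isRaisable eo (<ᵇ⇒< _ _ (subst Bool.T (sym ev) _)) eu (<ᵇ⇒< _ _ (subst Bool.T (sym el) _))
  ...     | false = contradiction refl h

  unview : ∀ {T R v s} → View T R v s → st (R , v) T ≡ s
  unview (isLowerable a b e) rewrite a | <⇒<ᵇ-true b | e = refl
  unview (isRaisable a b e f) rewrite a | <⇒<ᵇ-true b | e | <⇒<ᵇ-true f = refl

  lowerable⇒occurs : ∀ {T R v} → View T R (suc v) lowerable →
                     cnt (suc v) (lookup T R) < cnt (suc (suc v)) (lookup T R)
  lowerable⇒occurs {T} {R} {v} (isLowerable _ _ e) =
    subst₂ _<_ (rowCnt-lookup T R (suc v)) (rowCnt-lookup T R (suc (suc v)))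
      (<-≤-trans (odd-∸⇒< e) (m⊓n≤m _ _))

  raisable⇒occurs : ∀ {T R v} → View T R (suc v) raisable →
                    cnt v (lookup T R) < cnt (suc v) (lookup T R)
  raisable⇒occurs {T} {R} {v} (isRaisable _ _ _ l) =
    subst₂ _<_ (rowCnt-lookup T R v) (rowCnt-lookup T R (suc v)) (≤-<-trans (m≤m⊔n _ _) l)

  G-flip-≢ : ∀ T R v n w → ¬ (n ≡ suc (toℕ R) × w ≡ v) → G (flip (R , v) T) n w ≡ G T n w
  G-flip-≢ T R v zero w h = refl
  G-flip-≢ T R v (suc n) w h with n ≟ toℕ R
  ... | no n≢R = rowCnt-updateAt-≢ T R _ w n≢R
  ... | yes refl = begin
    rowCnt (flip (R , v) T) (toℕ R) w         ≡⟨ rowCnt-updateAt T R _ w ⟩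
    cnt w (move (st (R , v) T) v (lookup T R)) ≡⟨ cnt-move-≢ (st (R , v) T) v (lookup T R) (λ e → h (refl , e)) ⟩
    cnt w (lookup T R)                        ≡⟨ rowCnt-lookup T R w ⟨
    rowCnt T (toℕ R) w                        ∎
    where open ≡-Reasoning

  G-flip : ∀ T R v → st (R , v) T ≢ stuck →
           G (flip (R , v) T) (suc (toℕ R)) v ≡ shift (st (R , v) T) (G T (suc (toℕ R)) v)
  G-flip T R v h = trans (rowCnt-updateAt T R _ v)
    (trans (moved (view T R v h)) (cong (shift (st (R , v) T)) (sym (rowCnt-lookup T R v))))
    where
    moved : ∀ {v s} → View T R v s → cnt v (move s v (lookup T R)) ≡ shift s (cnt v (lookup T R))
    moved {suc v} V@(isLowerable _ _ _) = cnt-decLeftmost v (lookup T R) (lowerable⇒occurs V)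
    moved {suc v} V@(isRaisable _ _ _ _) = cong pred (cnt-incRightmost v (lookup T R) (raisable⇒occurs V))

  st≢stuck⇒odd : ∀ T R v → st (R , v) T ≢ stuck → isOddᵇ v ≡ true
  st≢stuck⇒odd T R v h with st (R , v) T | view T R v h
  ... | _ | isLowerable o _ _ = o
  ... | _ | isRaisable o _ _ _ = o

  -- The source of independence: flips alter only odd columns of `G`, while `lower` and `upper` at
  -- an odd value read only even ones.
  G-flip-even : ∀ T p n w → st p T ≢ stuck → isOddᵇ w ≡ false → G (flip p T) n w ≡ G T n w
  G-flip-even T p n w h e = G-flip-≢ T (proj₁ p) (proj₂ p) n w λ (_ , w≡v) →
    contradiction (trans (sym (st≢stuck⇒odd T (proj₁ p) (proj₂ p) h)) (trans (cong isOddᵇ (sym w≡v)) e)) λ ()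

  lower-flip : ∀ T p n v → st p T ≢ stuck → isOddᵇ (suc v) ≡ true → lower (flip p T) n (suc v) ≡ lower T n (suc v)
  lower-flip T p n v h o = 
    cong₂ _⊔_ (G-flip-even T p (suc n) v h (odd-suc⇒even v o))
              (G-flip-even T p (suc (suc n)) (suc (suc v)) h (odd-suc⇒even v o))

  upper-flip : ∀ T p n v → st p T ≢ stuck → isOddᵇ (suc v) ≡ true → upper (flip p T) n (suc v) ≡ upper T n (suc v)
  upper-flip T p n v h o = 
    cong₂ _⊓_ (G-flip-even T p (suc n) (suc (suc v)) h (odd-suc⇒even v o))
              (G-flip-even T p n v h (odd-suc⇒even v o))

  st-flip-≢ : ∀ {p q T} → p ≢ q → Valid T → st q T ≢ stuck → st p (flip q T) ≡ st p T
  st-flip-≢ {R , zero} p≢q V h = refl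
  st-flip-≢ {R , suc v} {S , w} {T} p≢q V h with isOddᵇ (suc v) in o
  ... | false = refl
  ... | true rewrite lower-flip T (S , w) (toℕ R) v h o | upper-flip T (S , w) (toℕ R) v h o
    | G-flip-≢ T S w (suc (toℕ R)) (suc v)
        (λ (e , e') → p≢q (cong₂ _,_ (toℕ-injective (suc-injective e)) e')) = refl

  -- The interval stays fixed while the count moves by one, which changes the parity of its distance
  -- to the upper end; after a lowering the count also lies strictly above the lower end.
  st-flip : ∀ {p T} → Valid T → st p T ≢ stuck → st p (flip p T) ≡ opposite (st p T)
  st-flip {R , v} {T} V h = go (view T R v h)
    where
    T' = flip (R , v) T
    n = toℕ R
    go : View T R v (st (R , v) T) → st (R , v) T' ≡ opposite (st (R , v) T)
    go V' with st (R , v) T | V' | G-flip T R v h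
      | lower-flip T (R , v) n (pred v) h | upper-flip T (R , v) n (pred v) h
    ... | _ | isLowerable {v} o b e | eqN | eqL | eqU =
      unview {T = updateAt T R (move lowerable (suc v))} (isRaisable o b
      (trans (cong₂ (λ x y → isOddᵇ (x ∸ y)) (eqU o) eqN)
        (trans (not-flip (isOddᵇ-∸ (G T (suc n) (suc v)) (upper T n (suc v)) (odd-∸⇒< e))) (cong not e)))
      (subst₂ _<_ (sym (eqL o)) (sym eqN) (s≤s (lower≤ V n (suc v)))))
    ... | _ | isRaisable {v} o b e l | eqN | eqL | eqU =
      unview {T = updateAt T R (move raisable (suc v))} (isLowerable o b
      (trans (cong₂ (λ x y → isOddᵇ (x ∸ y)) (eqU o) eqN) (odd-pred l (≤upper V n v) e)))
      where
      odd-pred : ∀ {lo x hi} → lo < x → x ≤ hi → isOddᵇ (hi ∸ x) ≡ false → isOddᵇ (hi ∸ pred x) ≡ true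
      odd-pred {x = suc x} {hi} _ p e = trans (isOddᵇ-∸ x hi p) (cong not e)

  -- An odd distance to the upper end is positive, which leaves room for adding one; a raisable
  -- count exceeds the lower end, which leaves room for subtracting one.
  flip-bounds : ∀ {R v T} → Valid T → st (R , v) T ≢ stuck →
    lower T (toℕ R) v ≤ G (flip (R , v) T) (suc (toℕ R)) v
    × G (flip (R , v) T) (suc (toℕ R)) v ≤ upper T (toℕ R) v
  flip-bounds {R} {v} {T} V h rewrite G-flip T R v h with st (R , v) T | view T R v h
  ... | _ | isLowerable {v} o b e = m≤n⇒m≤1+n (lower≤ V (toℕ R) (suc v)) , odd-∸⇒< e
  ... | _ | isRaisable {v} o b e l = <⇒≤pred l , ≤-trans pred[n]≤n (≤upper V (toℕ R) v)

  st≢stuck⇒< : ∀ T R v → st (R , v) T ≢ stuck → v < r + t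
  st≢stuck⇒< T R v h with st (R , v) T | view T R v h
  ... | _ | isLowerable _ b _ = b
  ... | _ | isRaisable _ b _ _ = b

  flip-valid : ∀ {p T} → Valid T → st p T ≢ stuck → Valid (flip p T)
  flip-valid {R , v} {T} V@(valid srt inter full) h = valid srt' inter' full'
    where
    T' = flip (R , v) T
    srt' : ∀ S → Sorted (lookup T' S)
    srt' S with S Fin.≟ R
    ... | yes refl = subst Sorted (sym (VP.lookup∘updateAt R T)) (move-sorted (st (R , v) T) v (srt R))
    ... | no S≢R = subst Sorted (sym (VP.lookup∘updateAt′ S R S≢R T)) (srt S)
    inter' : ∀ n w → G T' (suc n) (suc w) ≤ G T' n w
    -- The changed count can stand on the left, where `upper` bounds it, or on the right, where
    -- `lower` does; otherwise the inequality is an old one.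
    inter' n w with (suc n ≟ suc (toℕ R)) ×-dec (suc w ≟ v) | (n ≟ suc (toℕ R)) ×-dec (w ≟ v)
    ... | yes (refl , refl) | _ = ≤-trans (proj₂ (flip-bounds V h)) (≤-trans (m⊓n≤n _ _)
          (≤-reflexive (sym (G-flip-≢ T R v n w λ (e , _) → 1+n≢n (sym e)))))
    ... | no _ | yes (refl , refl) = ≤-trans
          (≤-reflexive (G-flip-≢ T R v (suc n) (suc w) λ (e , _) → 1+n≢n e))
          (≤-trans (m≤n⊔m _ _) (proj₁ (flip-bounds V h)))
    ... | no a | no b = subst₂ _≤_ (sym (G-flip-≢ T R v (suc n) (suc w) a)) (sym (G-flip-≢ T R v n w b)) (inter n w)
    full' : ∀ n → n < r → G T' (suc n) (r + t) ≡ c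
    -- Flipped positions satisfy `v < r + t`, so the column `r + t` is never altered.
    full' n p = trans (G-flip-≢ T R v (suc n) (r + t) λ (_ , e) → <⇒≢ (st≢stuck⇒< T R v h) (sym e)) (full n p)

  -- A valid tableau is determined by `G`, so it suffices that adding and subtracting one cancel at
  -- a single place; `decLeftmost` and `incRightmost` need not be composed.
  flip-flip : ∀ {p T} → Valid T → st p T ≢ stuck → flip p (flip p T) ≡ T
  flip-flip {R , v} {T} V h = G-injective (flip-valid {R , v} (flip-valid {R , v} V h) h') V pointwise
    where
    T' = flip (R , v) T
    h' : st (R , v) T' ≢ stuck
    h' = opposite≢stuck (st-flip {R , v} V h) h
    cancel : ∀ {s} → View T R v s → shift (opposite s) (shift s (G T (suc (toℕ R)) v)) ≡ G T (suc (toℕ R)) v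
    cancel (isLowerable _ _ _) = refl
    cancel (isRaisable _ _ _ l) = suc-pred _ ⦃ >-nonZero (≤-<-trans z≤n l) ⦄
    pointwise : ∀ n w → G (flip (R , v) T') n w ≡ G T n w
    pointwise n w with (n ≟ suc (toℕ R)) ×-dec (w ≟ v)
    ... | no a = trans (G-flip-≢ T' R v n w a) (G-flip-≢ T R v n w a)
    ... | yes (refl , refl) = begin
      G (flip (R , v) T') n w                                    ≡⟨ G-flip T' R v h' ⟩
      shift (st (R , v) T') (G T' n w)                           ≡⟨ cong₂ shift (st-flip {R , v} V h) (G-flip T R v h) ⟩
      shift (opposite (st (R , v) T)) (shift (st (R , v) T) (G T n w)) ≡⟨ cancel (view T R v h) ⟩
      G T n w                                                    ∎
      where open ≡-Reasoning

  -- Compared through `G` again: each count is changed by at most one of the two flips, and by the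
  -- same amount in either order.
  flip-comm : ∀ {p q T} → p ≢ q → Valid T → st p T ≢ stuck → st q T ≢ stuck →
              flip q (flip p T) ≡ flip p (flip q T)
  flip-comm {p@(R , v)} {q@(S , w)} {T} p≢q V hp hq =
    G-injective (flip-valid {q} (flip-valid {p} V hp) hq') (flip-valid {p} (flip-valid {q} V hq) hp') pointwise
    where
    open ≡-Reasoning
    stq = st-flip-≢ {q} {p} {T} (p≢q ∘ sym) V hp
    stp = st-flip-≢ {p} {q} {T} p≢q V hq
    hq' : st q (flip p T) ≢ stuck
    hq' = hq ∘ trans (sym stq)
    hp' : st p (flip q T) ≢ stuck
    hp' = hp ∘ trans (sym stp)
    disjoint : ∀ {n u} → (n ≡ suc (toℕ R) × u ≡ v) → ¬ (n ≡ suc (toℕ S) × u ≡ w)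
    disjoint (refl , refl) (e , e') = p≢q (cong₂ _,_ (toℕ-injective (suc-injective e)) e')
    pointwise : ∀ n u → G (flip q (flip p T)) n u ≡ G (flip p (flip q T)) n u
    pointwise n u with (n ≟ suc (toℕ R)) ×-dec (u ≟ v) | (n ≟ suc (toℕ S)) ×-dec (u ≟ w)
    ... | yes a | yes b = contradiction b (disjoint a)
    ... | no a | no b =
      trans (trans (G-flip-≢ (flip p T) S w n u b) (G-flip-≢ T R v n u a))
        (sym (trans (G-flip-≢ (flip q T) R v n u a) (G-flip-≢ T S w n u b)))
    ... | yes (refl , refl) | no b = begin
      G (flip q (flip p T)) n u                  ≡⟨ G-flip-≢ (flip p T) S w n u b ⟩
      G (flip p T) n u                           ≡⟨ G-flip T R v hp ⟩
      shift (st p T) (G T n u)                   ≡⟨ cong₂ shift stp (G-flip-≢ T S w n u b) ⟨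
      shift (st p (flip q T)) (G (flip q T) n u) ≡⟨ G-flip (flip q T) R v hp' ⟨
      G (flip p (flip q T)) n u                  ∎
    ... | no a | yes (refl , refl) = begin
      G (flip q (flip p T)) n u                  ≡⟨ G-flip (flip p T) S w hq' ⟩
      shift (st q (flip p T)) (G (flip p T) n u) ≡⟨ cong₂ shift stq (G-flip-≢ T R v n u a) ⟩
      shift (st q T) (G T n u)                   ≡⟨ G-flip T S w hq ⟨
      G (flip q T) n u                           ≡⟨ G-flip-≢ (flip q T) R v n u a ⟨
      G (flip p (flip q T)) n u                  ∎

  open Homotopy Valid st flip
    (λ {p} {T} → st-flip {p} {T}) (λ {p} {T} → flip-flip {p} {T})
    (λ {p} {q} {T} → st-flip-≢ {p} {q} {T}) (λ {p} {q} {T} → flip-comm {p} {q} {T}) public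

-- Free occurrences and the matching conditions

-- Obtained from the two counting identities by subtraction. In the first row the minimum is taken
-- with the virtual row, whose count `c` is an upper bound anyway.
freeCount-upper : ∀ {r c t} {T : Tab r c} → IsSSYT r c t T → ∀ R v →
  freeCount T R (suc v) ≡ upper T (toℕ R) (suc v) ∸ G T (suc (toℕ R)) (suc v)
freeCount-upper {r} {c} {t} {T} (_ , inc , strict) R v = begin
  freeCount T R (suc v)
    ≡⟨ m+n∸n≡m (freeCount T R (suc v)) (cnt (suc v) (lookup T R)) ⟨
  freeCount T R (suc v) + cnt (suc v) (lookup T R) ∸ cnt (suc v) (lookup T R)
    ≡⟨ cong₂ _∸_ (total R strict inc) (sym (rowCnt-lookup T R (suc v))) ⟩
  upper T (toℕ R) (suc v) ∸ G T (suc (toℕ R)) (suc v) ∎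
  where
  open ≡-Reasoning
  total : ∀ {r} {T : Tab r c} R →
    (∀ (R R' : Fin r) j → toℕ R < toℕ R' → entry T R j < entry T R' j) →
    (∀ R j j' → toℕ j ≤ toℕ j' → entry T R j ≤ entry T R j') →
    freeCount T R (suc v) + cnt (suc v) (lookup T R) ≡ rowCnt T (toℕ R) (suc (suc v)) ⊓ G T (toℕ R) v
  total {T = T} zero strict inc = trans (countFree-nothing (suc v) (lookup T zero))
    (trans (sym (rowCnt-lookup T zero (suc (suc v)))) (sym (m≤n⇒m⊓n≡m (G≤c T 1 (suc (suc v))))))
  total {T = T} (suc R) strict inc = trans
    (countFree-just v (lookup T (inject₁ R)) (lookup T (suc R)) (sorted (inc (inject₁ R))) (sorted (inc (suc R)))
      (λ j → strict (inject₁ R) (suc R) j (s≤s (≤-reflexive (toℕ-inject₁ R)))))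
    (cong₂ _⊓_ (sym (rowCnt-lookup T (suc R) (suc (suc v))))
      (trans (sym (rowCnt-lookup T (inject₁ R) v)) (cong (λ n → rowCnt T n v) (toℕ-inject₁ R))))

odd⇒isOddᵇ : ∀ {n} → Odd n → isOddᵇ n ≡ true
odd⇒isOddᵇ {n} = cong (_≡ᵇ 1)

isOddᵇ⇒odd : ∀ {n} → isOddᵇ n ≡ true → Odd n
isOddᵇ⇒odd {n} = isOddᵇ⇒%2 n 1

even⇒isOddᵇ : ∀ {n} → Even n → isOddᵇ n ≡ false
even⇒isOddᵇ {n} = cong (_≡ᵇ 1)

isOddᵇ⇒even : ∀ {n} → isOddᵇ n ≡ false → Even n
isOddᵇ⇒even {n} = isOddᵇ⇒%2 n 0

module _ {r c t : ℕ} {T : Tab r c} (ssyt : IsSSYT r c t T) where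

  private
    V : Valid t T
    V = IsSSYT⇒Valid t ssyt
    srt = Valid.rows-sorted V

  Cond1⇒lowerable : ∀ {R i} → Cond1 T R i → st t (R , i) T ≡ lowerable
  Cond1⇒lowerable {R} {zero} (() , _)
  Cond1⇒lowerable {R} {suc i} (o , occ , free) = unview t {T} (isLowerable (odd⇒isOddᵇ {suc i} o) i<
    (trans (cong isOddᵇ (sym (freeCount-upper {T = T} ssyt R i))) (odd⇒isOddᵇ {freeCount T R (suc i)} free)))
    where
    i< : suc i < r + t
    -- If `r + t` were at most `suc i`, all `c` entries of the row would lie below `suc i`, which
    -- could then not occur.
    i< = ≰⇒> λ p → <⇒≱ (0<count⇒occurs (suc i) (lookup T R) occ) (begin
      cnt (suc (suc i)) (lookup T R)  ≤⟨ cnt≤c (suc (suc i)) (lookup T R) ⟩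
      c                               ≡⟨ Valid.full V (toℕ R) (toℕ<n R) ⟨
      rowCnt T (toℕ R) (r + t)        ≡⟨ rowCnt-lookup T R (r + t) ⟩
      cnt (r + t) (lookup T R)        ≤⟨ cnt-mono (lookup T R) p ⟩
      cnt (suc i) (lookup T R)        ∎)
      where open ≤-Reasoning

  lowerable⇒Cond1 : ∀ {R i} → View t T R i lowerable → Cond1 T R i
  lowerable⇒Cond1 {R} {suc i} W@(isLowerable o _ e) =
    isOddᵇ⇒odd {suc i} o , occurs⇒0<count (suc i) (lookup T R) (lowerable⇒occurs t W) ,
    isOddᵇ⇒odd {freeCount T R (suc i)} (trans (cong isOddᵇ (freeCount-upper {T = T} ssyt R i)) e)

  raisable⇒Cond2 : ∀ {R i} → View t T R (suc i) raisable → Cond2 r c t T R i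
  raisable⇒Cond2 {R} {i} W@(isRaisable o b e l) =
    isOddᵇ⇒even {i} (odd-suc⇒even i o) , ∸-monoˡ-≤ 1 b ,
    occurs⇒0<count i (lookup T R) (raisable⇒occurs t W) , notBelow ,
    isOddᵇ⇒even {freeCount T R (suc i)} (trans (cong isOddᵇ (freeCount-upper {T = T} ssyt R i)) e)
    where
    -- An entry `suc i` under column `j` would make the count of the row below, and with it `lower`,
    -- exceed `toℕ j`. Then the larger count of row `R` reaches the next column, which also holds
    -- `i`.
    notBelow : ∀ j → entry T R j ≡ i → (∀ j' → toℕ j < toℕ j' → entry T R j' ≢ i) →
               ∀ R' → toℕ R' ≡ suc (toℕ R) → entry T R' j ≢ suc i
    notBelow j x≡i rightmost R' R'≡ y≡ = rightmost j' j<j' (≤-antisym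
        (≤-pred (index<cnt⇒< (srt R) j' (subst (_< cnt (suc i) (lookup T R)) (sym j'≡) suc-j<)))
        (subst (_≤ entry T R j') x≡i (Sorted.mono (srt R) j j' (<⇒≤ j<j'))))
      where
      open ≤-Reasoning
      suc-j< : suc (toℕ j) < cnt (suc i) (lookup T R)
      suc-j< = begin-strict
        suc (toℕ j)                             ≤⟨ <⇒index<cnt (srt R') j (s≤s (≤-reflexive y≡)) ⟩
        cnt (suc (suc i)) (lookup T R')         ≡⟨ rowCnt-lookup T R' (suc (suc i)) ⟨
        rowCnt T (toℕ R') (suc (suc i))         ≡⟨ cong (λ n → rowCnt T n (suc (suc i))) R'≡ ⟩
        rowCnt T (suc (toℕ R)) (suc (suc i))    ≤⟨ m≤n⊔m _ _ ⟩
        lower T (toℕ R) (suc i)               <⟨ l ⟩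
        rowCnt T (toℕ R) (suc i)                ≡⟨ rowCnt-lookup T R (suc i) ⟩
        cnt (suc i) (lookup T R)                ∎
      j'< : suc (toℕ j) < c
      j'< = <-≤-trans suc-j< (cnt≤c (suc i) (lookup T R))
      j' : Fin c
      j' = fromℕ< j'<
      j'≡ : toℕ j' ≡ suc (toℕ j)
      j'≡ = toℕ-fromℕ< j'<
      j<j' : toℕ j < toℕ j'
      j<j' = ≤-reflexive (sym j'≡)

  Cond2⇒raisable : ∀ {R i} → Cond2 r c t T R i → st t (R , suc i) T ≡ raisable
  Cond2⇒raisable {R} {i} (ev , i< , occ , notBelow , free) = unview t {T} (isRaisable
      (trans (isOddᵇ-suc i) (cong not (even⇒isOddᵇ {i} ev)))
      (pred-cancel-< {suc i} i<)
      (trans (cong isOddᵇ (sym (freeCount-upper {T = T} ssyt R i))) (even⇒isOddᵇ {freeCount T R (suc i)} free))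
      (⊔-pres-<m (subst₂ _<_ (sym (rowCnt-lookup T R i)) (sym (rowCnt-lookup T R (suc i))) occurs) below))
    where
    occurs : cnt i (lookup T R) < cnt (suc i) (lookup T R)
    occurs = 0<count⇒occurs i (lookup T R) occ
    -- The column of the rightmost `i`: the last one counted at threshold `suc i`.
    k : ℕ
    k = pred (cnt (suc i) (lookup T R))
    suc-k : suc k ≡ cnt (suc i) (lookup T R)
    suc-k = suc-pred _ ⦃ >-nonZero (≤-<-trans z≤n occurs) ⦄
    k<c : k < c
    k<c = subst (_≤ c) (sym suc-k) (cnt≤c (suc i) (lookup T R))
    j : Fin c
    j = fromℕ< k<c
    suc-j : suc (toℕ j) ≡ cnt (suc i) (lookup T R)
    suc-j = trans (cong suc (toℕ-fromℕ< k<c)) suc-k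
    x≡i : entry T R j ≡ i
    x≡i = occurs⇒lookup (srt R) j (≤-reflexive suc-j) (≤-pred (subst (cnt i (lookup T R) <_) (sym suc-j) occurs))
    rightmost : ∀ j' → toℕ j < toℕ j' → entry T R j' ≢ i
    rightmost j' p e = <⇒≱ (<⇒index<cnt (srt R) j' (s≤s (≤-reflexive e))) (subst (_≤ toℕ j') suc-j p)
    below : rowCnt T (suc (toℕ R)) (suc (suc i)) < rowCnt T (toℕ R) (suc i)
    below = subst (rowCnt T (suc (toℕ R)) (suc (suc i)) <_) (trans suc-j (sym (rowCnt-lookup T R (suc i)))) (s≤s ≤j)
      where
      -- Under the last row the count is zero. Otherwise the entry below column `j` exceeds `i` and
      -- is not `suc i`, so that column is not counted.
      ≤j : rowCnt T (suc (toℕ R)) (suc (suc i)) ≤ toℕ j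
      ≤j with suc (toℕ R) <? r
      ... | no q = subst (_≤ toℕ j) (sym (rowCnt-outside T (suc (suc i)) (≮⇒≥ q))) z≤n
      ... | yes q = subst (_≤ toℕ j)
          (trans (sym (rowCnt-lookup T R' (suc (suc i)))) (cong (λ n → rowCnt T n (suc (suc i))) R'≡))
          (≮⇒≥ λ p → notBelow j x≡i rightmost R' R'≡ (≤-antisym (≤-pred (index<cnt⇒< (srt R') j p))
            (subst (_< entry T R' j) x≡i (proj₂ (proj₂ ssyt) R R' j (≤-reflexive (sym R'≡))))))
        where
        R' = fromℕ< q
        R'≡ : toℕ R' ≡ suc (toℕ R)
        R'≡ = toℕ-fromℕ< q

-- The boundary as a sum over positions

positions : ∀ r t → List (Fin r × ℕ)
positions r t = cartesianProduct (allFin r) (upTo (r + t))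

positions-unique : ∀ r t → Unique (positions r t)
positions-unique r t = Unique.cartesianProduct⁺ (Unique.allFin⁺ r) (Unique.upTo⁺ (r + t))

concatMap-cartesianProduct : ∀ {A B C : Set} (f : A × B → List C) xs ys →
  concatMap f (cartesianProduct xs ys) ≡ concatMap (λ x → concatMap (λ y → f (x , y)) ys) xs
concatMap-cartesianProduct f [] ys = refl
concatMap-cartesianProduct f (x ∷ xs) ys =
  trans (concatMap-++ f (map (x ,_) ys) (cartesianProduct xs ys))
    (cong₂ _++_ (concatMap-map f (x ,_) ys) (concatMap-cartesianProduct f xs ys))

-- An equality of lists, not only of chains: both sides run through the pairs in the same order and
-- agree cell by cell.
dTab≡∂ : ∀ {r c t} {T : Tab r c} → IsSSYT r c t T → dTab r c t T ≡ ∂ t (positions r t) T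
dTab≡∂ {r} {c} {t} {T} ssyt = sym (trans
    (concatMap-cartesianProduct _ (allFin r) (upTo (r + t)))
    (concatMap-cong (λ R → concatMap-congᴬ (All.tabulate (λ {v} v∈ → sym (cell R v (∈-upTo⁻ v∈))))) (allFin r)))
  where
  cell : ∀ R v → v < r + t →
    (if isOddᵇ v ∧ (0 <ᵇ occCount T R v) ∧ isOddᵇ (freeCount T R v) then updateAt T R (decLeftmost v) ∷ [] else [])
    ≡ ifLowerable (st t (R , v) T) (flip t (R , v) T)
  cell R zero v< = refl
  cell R (suc v) v< with isOddᵇ (suc v)
  ... | false = refl
  ... | true rewrite <⇒<ᵇ-true v< with freeCount-upper {T = T} ssyt R v
  ...   | eq with isOddᵇ (upper T (toℕ R) (suc v) ∸ G T (suc (toℕ R)) (suc v)) in e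
  ...     | true rewrite eq | e | <⇒<ᵇ-true (0<countFree⇒0<count (above T R) (lookup T R) (suc v)
              (subst (0 <_) (sym eq) (m<n⇒0<n∸m {G T (suc (toℕ R)) (suc v)} {upper T (toℕ R) (suc v)}
                (odd-∸⇒< {G T (suc (toℕ R)) (suc v)} {upper T (toℕ R) (suc v)} e)))) = refl
  -- With an even free count both cells are empty, however the remaining tests turn out.
  ...     | false rewrite eq | e with 0 <ᵇ occCount T R (suc v) | lower T (toℕ R) (suc v) <ᵇ G T (suc (toℕ R)) (suc v)
  ...       | true | true = refl
  ...       | true | false = refl
  ...       | false | true = refl
  ...       | false | false = refl

norm-updateAt : ∀ {r c} (T : Tab r c) R f → V.sum (f (lookup T R)) ≡ suc (V.sum (lookup T R)) →
                norm (updateAt T R f) ≡ suc (norm T)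
norm-updateAt (x V.∷ T) zero f h = cong (_+ norm T) h
norm-updateAt (x V.∷ T) (suc R) f h = trans (cong (V.sum x +_) (norm-updateAt T R f h)) (+-suc _ _)

-- Ranks

double : ℕ → ℕ
double zero = 0
double (suc k) = suc (suc (double k))

isOddᵇ-double : ∀ k → isOddᵇ (double k) ≡ false
isOddᵇ-double zero = refl
isOddᵇ-double (suc k) = isOddᵇ-double k

-- Parities of ∑ f over the columns 1, …, 2K and over the columns 0, …, 2K - 1.
oddSum evenSum : (ℕ → ℕ) → ℕ → Bool
oddSum f zero = false
oddSum f (suc K) = (isOddᵇ (f 1) xor isOddᵇ (f 2)) xor oddSum (f ∘ (2 +_)) K
evenSum f zero = false
evenSum f (suc K) = (isOddᵇ (f 0) xor isOddᵇ (f 1)) xor evenSum (f ∘ (2 +_)) K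

oddSum-const : ∀ n K → oddSum (λ _ → n) K ≡ false
oddSum-const n zero = refl
oddSum-const n (suc K) rewrite oddSum-const n K | xor-same (isOddᵇ n) = refl

evenSum-const : ∀ n K → evenSum (λ _ → n) K ≡ false
evenSum-const n zero = refl
evenSum-const n (suc K) rewrite evenSum-const n K | xor-same (isOddᵇ n) = refl

oddSum-+ : ∀ f g K → oddSum (λ w → f w + g w) K ≡ oddSum f K xor oddSum g K
oddSum-+ f g zero = refl
oddSum-+ f g (suc K)
  rewrite isOddᵇ-+ (f 1) (g 1) | isOddᵇ-+ (f 2) (g 2) | oddSum-+ (f ∘ (2 +_)) (g ∘ (2 +_)) K =
  solve 6 (λ a b a' b' x y → ((a :+ b) :+ (a' :+ b')) :+ (x :+ y) := ((a :+ a') :+ x) :+ ((b :+ b') :+ y)) refl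
    (isOddᵇ (f 1)) (isOddᵇ (g 1)) (isOddᵇ (f 2)) (isOddᵇ (g 2)) (oddSum (f ∘ (2 +_)) K) (oddSum (g ∘ (2 +_)) K)
  where open xor-∧-Solver

-- The two ranges of columns differ only at their ends, 0 and `double K`.
evenSum-telescope : ∀ f K → evenSum f K ≡ oddSum f K xor (isOddᵇ (f 0) xor isOddᵇ (f (double K)))
evenSum-telescope f zero = sym (xor-same (isOddᵇ (f 0)))
evenSum-telescope f (suc K) rewrite evenSum-telescope (f ∘ (2 +_)) K =
  solve 5 (λ a b e x y → (a :+ b) :+ (x :+ (e :+ y)) := ((b :+ e) :+ x) :+ (a :+ y)) refl
    (isOddᵇ (f 0)) (isOddᵇ (f 1)) (isOddᵇ (f 2)) (oddSum (f ∘ (2 +_)) K) (isOddᵇ (f (suc (suc (double K)))))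
  where open xor-∧-Solver

evenSum≡oddSum : ∀ f g K →
  (∀ k → k < K → isOddᵇ (f (double k)) xor isOddᵇ (f (suc (double k)))
                 ≡ isOddᵇ (g (suc (double k))) xor isOddᵇ (g (suc (suc (double k))))) →
  evenSum f K ≡ oddSum g K
evenSum≡oddSum f g zero h = refl
evenSum≡oddSum f g (suc K) h =
  cong₂ _xor_ (h 0 (s≤s z≤n)) (evenSum≡oddSum (f ∘ (2 +_)) (g ∘ (2 +_)) K (λ k p → h (suc k) (s≤s p)))

-- Among the thresholds from 1 to 2K exactly 2K - x exceed x, a number of the same parity as x.
isOddᵇ≡oddSum-lt : ∀ K x → x ≤ double K → isOddᵇ x ≡ oddSum (lt x) K
isOddᵇ≡oddSum-lt K zero p = sym (zero-lt K)
  where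
  zero-lt : ∀ K → oddSum (lt 0) K ≡ false
  zero-lt zero = refl
  zero-lt (suc K) = oddSum-const 1 K
isOddᵇ≡oddSum-lt (suc K) (suc zero) p = cong not (sym (oddSum-const 1 K))
isOddᵇ≡oddSum-lt (suc K) (suc (suc x)) (s≤s (s≤s p)) = isOddᵇ≡oddSum-lt K x p

isOddᵇ-sum : ∀ {c} K (xs : Vec ℕ c) → (∀ j → lookup xs j ≤ double K) →
             isOddᵇ (V.sum xs) ≡ oddSum (λ w → cnt w xs) K
isOddᵇ-sum K V.[] h = sym (oddSum-const 0 K)
isOddᵇ-sum K (x V.∷ xs) h = begin
  isOddᵇ (x + V.sum xs)                           ≡⟨ isOddᵇ-+ x (V.sum xs) ⟩
  isOddᵇ x xor isOddᵇ (V.sum xs)                  ≡⟨ cong₂ _xor_ (isOddᵇ≡oddSum-lt K x (h zero))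
                                                                (isOddᵇ-sum K xs (h ∘ suc)) ⟩
  oddSum (lt x) K xor oddSum (λ w → cnt w xs) K   ≡⟨ oddSum-+ (lt x) (λ w → cnt w xs) K ⟨
  oddSum (λ w → cnt w (x V.∷ xs)) K               ∎
  where open ≡-Reasoning

oddSum-cong : ∀ {f g} K → (∀ w → f w ≡ g w) → oddSum f K ≡ oddSum g K
oddSum-cong zero h = refl
oddSum-cong (suc K) h =
  cong₂ _xor_ (cong₂ (λ a b → isOddᵇ a xor isOddᵇ b) (h 1) (h 2)) (oddSum-cong K (λ w → h (suc (suc w))))

halve : ∀ n → Σ ℕ λ K → double K ≤ n × n ≤ suc (double K)
halve zero = 0 , z≤n , z≤n
halve (suc zero) = 0 , z≤n , s≤s z≤n
halve (suc (suc n)) with K , p , q ← halve n = suc K , s≤s (s≤s p) , s≤s (s≤s q)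

double-mono-≤ : ∀ {m n} → m ≤ n → double m ≤ double n
double-mono-≤ z≤n = z≤n
double-mono-≤ (s≤s p) = s≤s (s≤s (double-mono-≤ p))

-- The identity max + min = a + b mod 2, arranged so that the left side is a difference of columns
-- in one row of `G` and the right side one in the next row.
⊔-⊓-parity : ∀ a b → isOddᵇ a xor isOddᵇ (a ⊔ b) ≡ isOddᵇ (b ⊓ a) xor isOddᵇ b
⊔-⊓-parity a b with ≤-total a b
... | inj₁ p rewrite m≤n⇒m⊔n≡n p | m≥n⇒m⊓n≡n p = refl
... | inj₂ p rewrite m≥n⇒m⊔n≡m p | m≤n⇒m⊓n≡m p = trans (xor-same (isOddᵇ a)) (sym (xor-same (isOddᵇ b)))

module _ {r c t : ℕ} {T : Tab r c} (V : Valid t T)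
         (allStuck : ∀ R v → v < r + t → st t (R , v) T ≡ stuck) where

  -- Not being lowerable makes the distance to the upper end even; not being raisable then puts the
  -- count at the lower end.
  stuck⇒ : ∀ n v → n < r → isOddᵇ (suc v) ≡ true → suc v < r + t →
           G T (suc n) (suc v) ≡ lower T n (suc v)
           × isOddᵇ (G T (suc n) (suc v)) ≡ isOddᵇ (upper T n (suc v))
  stuck⇒ n v n< o v< = subst Claim (toℕ-fromℕ< n<) (claim (fromℕ< n<))
    where
    Claim : ℕ → Set
    Claim n = G T (suc n) (suc v) ≡ lower T n (suc v)
              × isOddᵇ (G T (suc n) (suc v)) ≡ isOddᵇ (upper T n (suc v))
    even-∸ : ∀ {x hi} → x ≤ hi → isOddᵇ (hi ∸ x) ≡ false → isOddᵇ x ≡ isOddᵇ hi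
    even-∸ {x} {hi} p e = begin
      isOddᵇ x                       ≡⟨ cong (_xor isOddᵇ x) e ⟨
      isOddᵇ (hi ∸ x) xor isOddᵇ x   ≡⟨ isOddᵇ-+ (hi ∸ x) x ⟨
      isOddᵇ (hi ∸ x + x)            ≡⟨ cong isOddᵇ (m∸n+n≡m p) ⟩
      isOddᵇ hi                      ∎
      where open ≡-Reasoning
    claim : ∀ R → Claim (toℕ R)
    claim R with isOddᵇ (upper T (toℕ R) (suc v) ∸ G T (suc (toℕ R)) (suc v)) in e
    ... | true = contradiction (trans (sym (unview t {T} (isLowerable o v< e))) (allStuck R (suc v) v<)) λ ()
    ... | false = ≤-antisym (≮⇒≥ λ l → contradiction
                    (trans (sym (unview t {T} (isRaisable o v< e l))) (allStuck R (suc v) v<)) λ ())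
                    (lower≤ t V (toℕ R) (suc v)) ,
                  even-∸ (≤upper t V (toℕ R) v) e

  -- Induction on the rows: `next` passes from one row to the following one, and telescoping turns
  -- `evenSum` back into `oddSum` at the cost of the end terms 0 and `c`. Hence each row adds `c`.
  rowParity : ∀ K → double K ≤ r + t → r + t ≤ suc (double K) → ∀ n → n < r →
              oddSum (G T (suc n)) K ≡ isOddᵇ (n * c)
  rowParity K lo hi = go
    where
    open ≡-Reasoning
    column< : ∀ k → k < K → suc (double k) < r + t
    column< k p = ≤-trans (double-mono-≤ p) lo
    odd-column : ∀ k → isOddᵇ (suc (double k)) ≡ true
    odd-column k = trans (isOddᵇ-suc (double k)) (cong not (isOddᵇ-double k))
    -- It holds for the virtual row as well, since a maximum with `c` is `c`.
    atLower : ∀ n k → n ≤ r → k < K →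
              G T n (suc (double k)) ≡ G T n (double k) ⊔ G T (suc n) (suc (suc (double k)))
    atLower zero k n≤ p = sym (m≥n⇒m⊔n≡m (G≤c T 1 (suc (suc (double k)))))
    atLower (suc n) k n< p = proj₁ (stuck⇒ n (double k) n< (odd-column k) (column< k p))
    -- Differences of adjacent columns count occurrences, so this compares, mod 2, the even entries
    -- below 2K in one row with the odd entries below 2K in the next.
    next : ∀ n → n < r → evenSum (G T n) K ≡ oddSum (G T (suc n)) K
    next n n< = evenSum≡oddSum (G T n) (G T (suc n)) K λ k p → begin
      isOddᵇ (G T n (double k)) xor isOddᵇ (G T n (suc (double k)))
        ≡⟨ cong (λ x → isOddᵇ (G T n (double k)) xor isOddᵇ x) (atLower n k (<⇒≤ n<) p) ⟩
      isOddᵇ (G T n (double k)) xor isOddᵇ (G T n (double k) ⊔ G T (suc n) (suc (suc (double k))))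
        ≡⟨ ⊔-⊓-parity (G T n (double k)) (G T (suc n) (suc (suc (double k)))) ⟩
      isOddᵇ (upper T n (suc (double k))) xor isOddᵇ (G T (suc n) (suc (suc (double k))))
        ≡⟨ cong (_xor isOddᵇ (G T (suc n) (suc (suc (double k)))))
             (proj₂ (stuck⇒ n (double k) n< (odd-column k) (column< k p))) ⟨
      isOddᵇ (G T (suc n) (suc (double k))) xor isOddᵇ (G T (suc n) (suc (suc (double k)))) ∎
    -- The unpaired top value 2K, present when r + t is odd, only occurs in the last row.
    full-row : ∀ n → suc n < r → G T (suc n) (double K) ≡ c
    full-row n p = ≤-antisym (G≤c T (suc n) (double K)) (≤-trans (≤-reflexive (sym (Valid.full V (suc n) p)))
      (≤-trans (G-mono T (suc (suc n)) hi) (Valid.interlace V (suc n) (double K))))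
    G-zero : ∀ n → G T (suc n) 0 ≡ 0
    G-zero n = n≤0⇒n≡0 (rowCnt-zero T n)
      where
      rowCnt-zero : ∀ {r} (T : Tab r c) n → rowCnt T n 0 ≤ 0
      rowCnt-zero V.[] n = z≤n
      rowCnt-zero (x V.∷ T) zero = ≤-reflexive (cnt-none 0 x (λ _ → z≤n))
      rowCnt-zero (x V.∷ T) (suc n) = rowCnt-zero T n
    go : ∀ n → n < r → oddSum (G T (suc n)) K ≡ isOddᵇ (n * c)
    go zero p = trans (sym (next 0 p)) (evenSum-const c K)
    go (suc n) p = begin
      oddSum (G T (suc (suc n))) K
        ≡⟨ next (suc n) p ⟨
      evenSum (G T (suc n)) K
        ≡⟨ evenSum-telescope (G T (suc n)) K ⟩
      oddSum (G T (suc n)) K xor (isOddᵇ (G T (suc n) 0) xor isOddᵇ (G T (suc n) (double K)))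
        ≡⟨ cong₂ _xor_ (go n (<-trans (n<1+n n) p))
             (cong₂ (λ a b → isOddᵇ a xor isOddᵇ b) (G-zero n) (full-row n p)) ⟩
      isOddᵇ (n * c) xor isOddᵇ c
        ≡⟨ xor-comm (isOddᵇ (n * c)) (isOddᵇ c) ⟩
      isOddᵇ c xor isOddᵇ (n * c)
        ≡⟨ isOddᵇ-+ c (n * c) ⟨
      isOddᵇ (c + n * c) ∎

  rowSumParity : ∀ R → isOddᵇ (V.sum (lookup T R)) ≡ isOddᵇ (toℕ R * c)
  rowSumParity R with K , lo , hi ← halve (r + t) = begin
    isOddᵇ (V.sum (lookup T R))
      ≡⟨ isOddᵇ-sum K (lookup T R) (λ j → ≤-pred (≤-trans (proj₁ (Valid⇒IsSSYT t V) R j) hi)) ⟩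
    oddSum (λ w → cnt w (lookup T R)) K
      ≡⟨ oddSum-cong K (λ w → sym (rowCnt-lookup T R w)) ⟩
    oddSum (G T (suc (toℕ R))) K
      ≡⟨ rowParity K lo hi (toℕ R) (toℕ<n R) ⟩
    isOddᵇ (toℕ R * c) ∎
    where open ≡-Reasoning

-- The sum m + (m + 1) + ... + (m + r - 1); the offset `m` lets the recursion follow the rows of a
-- tableau.
consecutiveSum : ℕ → ℕ → ℕ
consecutiveSum m zero = 0
consecutiveSum m (suc r) = m + consecutiveSum (suc m) r

consecutiveSum-C : ∀ m r → consecutiveSum m r ≡ r * m + r C 2
consecutiveSum-C m zero = refl
consecutiveSum-C m (suc r) = begin
  m + consecutiveSum (suc m) r     ≡⟨ cong (m +_) (consecutiveSum-C (suc m) r) ⟩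
  m + (r * suc m + r C 2)          ≡⟨ rearrange m r (r C 2) ⟩
  m + r * m + (r + r C 2)          ≡⟨ cong (λ x → m + r * m + (x + r C 2)) (nC1≡n r) ⟨
  m + r * m + (r C 1 + r C 2)      ≡⟨ cong (m + r * m +_) (nCk+nC[k+1]≡[n+1]C[k+1] r 1) ⟩
  m + r * m + suc r C 2            ∎
  where
  open ≡-Reasoning
  rearrange : ∀ m r x → m + (r * suc m + x) ≡ m + r * m + (r + x)
  rearrange = solve-∀

c*rC2 : ∀ r c → c * (r C 2) ≡ consecutiveSum 0 r * c
c*rC2 r c = trans (*-comm c (r C 2))
  (cong (_* c) (sym (trans (consecutiveSum-C 0 r) (cong (_+ r C 2) (*-zeroʳ r)))))

norm-parity : ∀ {r c} (T : Tab r c) m →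
  (∀ R → isOddᵇ (V.sum (lookup T R)) ≡ isOddᵇ ((m + toℕ R) * c)) →
  isOddᵇ (norm T) ≡ isOddᵇ (consecutiveSum m r * c)
norm-parity V.[] m h = refl
norm-parity {suc r} {c} (x V.∷ T) m h = begin
  isOddᵇ (V.sum x + norm T)
    ≡⟨ isOddᵇ-+ (V.sum x) (norm T) ⟩
  isOddᵇ (V.sum x) xor isOddᵇ (norm T)
    ≡⟨ cong₂ _xor_ (trans (h zero) (cong (λ n → isOddᵇ (n * c)) (+-identityʳ m)))
         (norm-parity T (suc m) (λ R → trans (h (suc R)) (cong (λ n → isOddᵇ (n * c)) (+-suc m (toℕ R))))) ⟩
  isOddᵇ (m * c) xor isOddᵇ (consecutiveSum (suc m) r * c)
    ≡⟨ isOddᵇ-+ (m * c) (consecutiveSum (suc m) r * c) ⟨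
  isOddᵇ (m * c + consecutiveSum (suc m) r * c)
    ≡⟨ cong isOddᵇ (*-distribʳ-+ c m (consecutiveSum (suc m) r)) ⟨
  isOddᵇ ((m + consecutiveSum (suc m) r) * c) ∎
  where open ≡-Reasoning

sum-≥ : ∀ {c} n (xs : Vec ℕ c) → (∀ j → n ≤ lookup xs j) → c * n ≤ V.sum xs
sum-≥ n V.[] h = z≤n
sum-≥ n (x V.∷ xs) h = +-mono-≤ (h zero) (sum-≥ n xs (h ∘ suc))

norm-≥ : ∀ {r c} (T : Tab r c) m → (∀ R j → m + toℕ R ≤ entry T R j) → consecutiveSum m r * c ≤ norm T
norm-≥ V.[] m h = z≤n
norm-≥ {suc r} {c} (x V.∷ T) m h = begin
  (m + consecutiveSum (suc m) r) * c        ≡⟨ *-distribʳ-+ c m (consecutiveSum (suc m) r) ⟩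
  m * c + consecutiveSum (suc m) r * c      ≡⟨ cong (_+ consecutiveSum (suc m) r * c) (*-comm m c) ⟩
  c * m + consecutiveSum (suc m) r * c      ≤⟨ +-mono-≤ (sum-≥ m x λ j → ≤-trans (m≤m+n m 0) (h zero j))
                                                 (norm-≥ T (suc m) λ R j →
                                                   ≤-trans (≤-reflexive (sym (+-suc m (toℕ R)))) (h (suc R) j)) ⟩
  V.sum x + norm T                          ∎
  where open ≤-Reasoning

entry-≥ : ∀ {r c} (T : Tab r c) → (∀ R R' j → toℕ R < toℕ R' → entry T R j < entry T R' j) →
          ∀ n R → toℕ R ≡ n → ∀ j → n ≤ entry T R j
entry-≥ T strict zero R e j = z≤n
entry-≥ T strict (suc n) (suc R) e j = ≤-<-trans
  (entry-≥ T strict n (inject₁ R) (trans (toℕ-inject₁ R) (suc-injective e)) j)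
  (strict (inject₁ R) (suc R) j (s≤s (≤-reflexive (toℕ-inject₁ R))))

-- Strict columns force the entries of row R, counted from 0, to be at least R. So the truncated
-- subtraction in `rank` is a genuine one, and parities and increments pass from `norm` to `rank`.
rank-exact : ∀ {r c t} {T : Tab r c} → IsSSYT r c t T → c * (r C 2) ≤ norm T
rank-exact {r} {c} {T = T} (_ , _ , strict) = ≤-trans (≤-reflexive (c*rC2 r c))
  (norm-≥ T 0 λ R j → entry-≥ T strict (toℕ R) R refl j)

allStuck⇒evenRank : ∀ {r c t} {T : Tab r c} → IsSSYT r c t T →
  (∀ R v → v < r + t → st t (R , v) T ≡ stuck) → isOddᵇ (rank T) ≡ false
allStuck⇒evenRank {r} {c} {t} {T} ssyt allStuck = cancel (begin
  isOddᵇ (rank T) xor isOddᵇ b          ≡⟨ isOddᵇ-+ (rank T) b ⟨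
  isOddᵇ (rank T + b)                   ≡⟨ cong isOddᵇ (m∸n+n≡m (rank-exact {t = t} {T} ssyt)) ⟩
  isOddᵇ (norm T)                       ≡⟨ norm-parity T 0 (rowSumParity (IsSSYT⇒Valid t {T} ssyt) allStuck) ⟩
  isOddᵇ (consecutiveSum 0 r * c)       ≡⟨ cong isOddᵇ (c*rC2 r c) ⟨
  isOddᵇ b                              ∎)
  where
  open ≡-Reasoning
  b = c * (r C 2)
  cancel : ∀ {x y} → x xor y ≡ y → x ≡ false
  cancel {false} _ = refl
  cancel {true} {false} ()
  cancel {true} {true} ()

-- Cycles, boundaries and unmatched tableaux

All-concatMap : ∀ {A B : Set} {P : A → Set} {Q : B → Set} {f : A → List B} →
                (∀ {x} → P x → All Q (f x)) → ∀ {xs} → All P xs → All Q (concatMap f xs)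
All-concatMap h [] = []
All-concatMap h (p ∷ ps) = All.++⁺ (h p) (All-concatMap h ps)

mult-∉ : ∀ {r c} {T : Tab r c} {x} → All (T ≢_) x → mult T x ≡ 0
mult-∉ {T = T} h = cong length (filter-none (T ≟ᵀ_) h)

module _ {r c t : ℕ} where

  private
    ps = positions r t

  d≡∂ : ∀ {z} → IsChain r c t z → d r c t z ≡ concatMap (∂ t ps) z
  d≡∂ = concatMap-congᴬ ∘ All.map (λ {T} → dTab≡∂ {T = T})

  allStuck⇒Unmatched : ∀ {T} → IsSSYT r c t T → (∀ R v → v < r + t → st t (R , v) T ≡ stuck) → Unmatched r c t T
  allStuck⇒Unmatched {T} ssyt allStuck R i =
    (λ C → excluded i (Cond1⇒lowerable {T = T} ssyt C) λ ()) ,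
    (λ C → excluded (suc i) (Cond2⇒raisable {T = T} ssyt C) λ ())
    where
    -- A status other than `stuck` forces `v < r + t`, so `allStuck` covers the position.
    excluded : ∀ v {s} → st t (R , v) T ≡ s → ¬ (s ≢ stuck)
    excluded v e s≢ = n (allStuck R v (st≢stuck⇒< t T R v n))
      where n = ≢stuck t {R , v} {T} e s≢

  π-spec : ∀ {T} → IsSSYT r c t T → All (λ S → S ≡ T × (∀ R v → v < r + t → st t (R , v) S ≡ stuck)) (π t ps T)
  π-spec ssyt = All.map
    (λ { (refl , s) → refl , λ R v v< → All.lookup s (∈-cartesianProduct⁺ (∈-allFin R) (∈-upTo⁺ v<)) })
    (π-all t ps)

  π-unmatched : ∀ {T} → IsSSYT r c t T → All (λ S → IsSSYT r c t S × Unmatched r c t S) (π t ps T)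
  π-unmatched {T} ssyt = All.map (λ { (refl , s) → ssyt , allStuck⇒Unmatched {T} ssyt s }) (π-spec {T} ssyt)

  -- A surviving term would be `T` itself, stuck at every position and therefore of even rank.
  π-odd : ∀ {T} → IsSSYT r c t T → isOddᵇ (rank T) ≡ true → π t ps T ≡ []
  π-odd {T} ssyt o with π t ps T | π-spec {T} ssyt
  ... | [] | _ = refl
  ... | _ ∷ _ | (refl , s) ∷ _ = contradiction (trans (sym o) (allStuck⇒evenRank {T = T} ssyt s)) λ ()

  η-spec : ∀ {T} → IsSSYT r c t T → All (λ S → IsSSYT r c t S × rank S ≡ suc (rank T)) (η t ps T)
  η-spec {T} ssyt = η-all t ps (All.universal raised ps)
    where
    V = IsSSYT⇒Valid t {T} ssyt
    raised : ∀ p → st t p T ≡ raisable → IsSSYT r c t (flip t p T) × rank (flip t p T) ≡ suc (rank T)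
    raised (R , v) e = Valid⇒IsSSYT t (flip-valid t {R , v} V n) , rank-suc (subst (View t T R v) e (view t T R v n))
      where
      n : st t (R , v) T ≢ stuck
      n = ≢stuck t {R , v} {T} e λ ()
      rank-suc : ∀ {v} → View t T R v raisable → rank (flip t (R , v) T) ≡ suc (rank T)
      rank-suc {suc v} W rewrite unview t {T} W = trans
        (cong (_∸ c * (r C 2)) (norm-updateAt T R (incRightmost v)
          (sum-incRightmost v (lookup T R) (raisable⇒occurs t W))))
        (+-∸-assoc 1 (rank-exact {t = t} {T} ssyt))

  unmatched-∂ : ∀ {T} → IsSSYT r c t T → Unmatched r c t T → ∂ t ps T ≡ []
  -- The predicate ignores the terms of the boundary: any term would exhibit a lowerable position,
  -- and so an instance of (1).
  unmatched-∂ {T} ssyt u = none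
    (∂-all t {λ _ → Σ (Fin r) λ R → Σ ℕ λ v → View t T R v lowerable} ps (All.universal found ps))
    where
    found : ∀ p → st t p T ≡ lowerable → Σ (Fin r) λ R → Σ ℕ λ v → View t T R v lowerable
    found (R , v) e = R , v , subst (View t T R v) e (view t T R v (≢stuck t {R , v} {T} e λ ()))
    none : ∀ {x : Chain r c} → All (λ _ → Σ (Fin r) λ R → Σ ℕ λ v → View t T R v lowerable) x → x ≡ []
    none [] = refl
    none ((R , v , W) ∷ _) = contradiction (lowerable⇒Cond1 {T = T} ssyt W) (proj₁ (u R v))

  -- A term of a boundary is raisable at the position just lowered, so it satisfies (2) there.
  unmatched∉∂ : ∀ {S T} → IsSSYT r c t S → Unmatched r c t T → All (T ≢_) (∂ t ps S)
  unmatched∉∂ {S} {T} ssyt u = ∂-all t ps (All.universal hit ps)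
    where
    V = IsSSYT⇒Valid t {S} ssyt
    hit : ∀ p → st t p S ≡ lowerable → T ≢ flip t p S
    hit (R , v) e refl = matched (subst (View t T R v) e' (view t T R v (≢stuck t {R , v} {T} e' λ ())))
      where
      n : st t (R , v) S ≢ stuck
      n = ≢stuck t {R , v} {S} e λ ()
      e' : st t (R , v) T ≡ raisable
      e' = trans (st-flip t {R , v} V n) (cong opposite e)
      matched : ∀ {w} → ¬ View t T R w raisable
      matched {suc i} W = proj₂ (u R i) (raisable⇒Cond2 {T = T} (Valid⇒IsSSYT t (flip-valid t {R , v} V n)) W)

  cycle : ∀ {z} → IsChain r c t z → d r c t z ≈ [] →
          z ∼ concatMap (π t ps) z ++ d r c t (concatMap (η t ps) z)
  cycle {z} cz dz≈0 = subst (λ y → z ∼ concatMap (π t ps) z ++ y) (sym (d≡∂ ηz-chain))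
    (cycle-decomposition t ps (positions-unique r t) z (All.map (λ {T} → IsSSYT⇒Valid t {T}) cz)
      (≈⇒∼ {x = concatMap (∂ t ps) z} {[]} (subst (_≈ []) (d≡∂ cz) dz≈0)))
    where
    ηz-chain : IsChain r c t (concatMap (η t ps) z)
    ηz-chain = All-concatMap (λ {T} s → All.map proj₁ (η-spec {T} s)) cz

theorem5p8 : (r c t : ℕ) → 1 ≤ r → 1 ≤ c → 1 ≤ t →
    (∀ (k : ℕ) → Odd k → (z : Chain r c) → IsChain r c t z → Homogeneous k z
    → d r c t z ≈ []
    → Σ (Chain r c) (λ w → IsChain r c t w × Homogeneous (suc k) w × (z ≈ d r c t w)))
    × (∀ (T : Tab r c) → IsSSYT r c t T → Unmatched r c t T → d r c t (T ∷ []) ≈ [])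
    × (∀ (z : Chain r c) → IsChain r c t z → d r c t z ≈ []
    → Σ (Chain r c) (λ u → All (λ T → IsSSYT r c t T × Unmatched r c t T) u
    × Σ (Chain r c) (λ w → IsChain r c t w × (z ≈ (u ++ d r c t w)))))
    × (∀ (u : Chain r c) → All (λ T → IsSSYT r c t T × Unmatched r c t T) u
    → (w : Chain r c) → IsChain r c t w → u ≈ d r c t w → u ≈ [])
theorem5p8 r c t _ _ _ = oddRank , cycles , spanning , independent
  where
  ps = positions r t

  oddRank : ∀ k → Odd k → (z : Chain r c) → IsChain r c t z → Homogeneous k z → d r c t z ≈ [] →
            Σ (Chain r c) λ w → IsChain r c t w × Homogeneous (suc k) w × (z ≈ d r c t w)
  oddRank k o z cz hz dz≈0 = w , All.map proj₁ w-spec , All.map proj₂ w-spec ,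
      ∼⇒≈ {x = z} {d r c t w} (subst (λ y → z ∼ y ++ d r c t w) πz≡[] (cycle cz dz≈0))
    where
    w = concatMap (η t ps) z
    w-spec : All (λ S → IsSSYT r c t S × rank S ≡ suc k) w
    w-spec = All-concatMap (λ { {T} (s , refl) → η-spec {T = T} s }) (All.zip (cz , hz))
    πz≡[] : concatMap (π t ps) z ≡ []
    πz≡[] = concatMap-nil
      (All.map (λ { {T} (s , refl) → π-odd {T = T} s (odd⇒isOddᵇ {k} o) }) (All.zip (cz , hz)))

  cycles : ∀ T → IsSSYT r c t T → Unmatched r c t T → d r c t (T ∷ []) ≈ []
  cycles T s u = subst (_≈ [])
    (sym (trans (++-identityʳ _) (trans (dTab≡∂ {T = T} s) (unmatched-∂ {T = T} s u)))) λ _ → refl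

  spanning : ∀ z → IsChain r c t z → d r c t z ≈ [] →
             Σ (Chain r c) λ u → All (λ T → IsSSYT r c t T × Unmatched r c t T) u
             × Σ (Chain r c) λ w → IsChain r c t w × (z ≈ (u ++ d r c t w))
  spanning z cz dz≈0 = concatMap (π t ps) z , All-concatMap (λ {T} → π-unmatched {T = T}) cz ,
    w , All-concatMap (λ {T} s → All.map proj₁ (η-spec {T = T} s)) cz ,
    ∼⇒≈ {x = z} {concatMap (π t ps) z ++ d r c t w} (cycle cz dz≈0)
    where
    w = concatMap (η t ps) z

  independent : ∀ u → All (λ T → IsSSYT r c t T × Unmatched r c t T) u →
                ∀ w → IsChain r c t w → u ≈ d r c t w → u ≈ []
  independent u us w cw u≈dw T with All.all? (λ S → ¬? (T ≟ᵀ S)) u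
  -- Coefficients are compared at `T`: either it does not occur in `u`, or it is unmatched and does
  -- not occur in `d r c t w`.
  ... | yes T∉u = cong (_% 2) (mult-∉ T∉u)
  ... | no T∈u = trans (u≈dw T) (cong (_% 2) (mult-∉ T∉dw))
    where
    unmatched : Unmatched r c t T
    unmatched with S , S∈u , T≡S ← find (All.¬All⇒Any¬ (λ S → ¬? (T ≟ᵀ S)) u T∈u)
      = subst (Unmatched r c t) (sym (decidable-stable (T ≟ᵀ S) T≡S)) (proj₂ (All.lookup us S∈u))
    T∉dw : All (T ≢_) (d r c t w)
    T∉dw = subst (All (T ≢_)) (sym (d≡∂ cw)) (All-concatMap (λ {S} s → unmatched∉∂ {S = S} {T} s unmatched) cw)
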